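{- Let $r\geq 2$ be an integer, let $c=r^{ -(r+7)(r+1)}$, let $n\geq e^{2/c}$ be an integer, and let $G$ be a graph of order $n$ with exactly $t_r(n)+1$ edges. Then $G$ contains a (not necessarily induced) subgraph isomorphic to $K_r^+\left(\lfloor c\ln n\rfloor,\ldots,\lfloor c\ln n\rfloor\right)$, i.e. with all $r$ parts of size $\lfloor c\ln n\rfloor$.
   Context: $t_r(n)$ denotes the number of edges of the $r$-partite Turán graph of order $n$ (the complete $r$-partite graph on $n$ vertices with part sizes as equal as possible). For integers $s_1\geq 2,s_2,\ldots,s_r\geq 1$, $K_r^+(s_1,\ldots,s_r)$ denotes the complete $r$-partite graph with parts of sizes $s_1,\ldots,s_r$ together with one additional edge joining two vertices of the first part (the part of size $s_1$). -}

module Defs where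

open import Data.Nat using (ℕ; zero; suc; _+_; _*_; _^_; _≤_; _≡ᵇ_; _<ᵇ_; _!)
open import Data.Nat.ListAction using (sum)
open import Data.Bool using (Bool; true; false; not; _∧_; _∨_; if_then_else_)
open import Data.Fin using (Fin; toℕ)
open import Data.List using (List; map; cartesianProduct)
open import Data.Fin.Base using ()
open import Data.List using (allFin)
open import Data.Product using (_×_; _,_; Σ; proj₁; proj₂)
open import Relation.Binary.PropositionalEquality using (_≡_)
open import Function.Definitions using (Injective)

record Graph (n : ℕ) : Set where
  field
    adj    : Fin n → Fin n → Bool
    sym    : ∀ i j → adj i j ≡ adj j i
    irrefl : ∀ i → adj i i ≡ false
open Graph public

countPairs : (n : ℕ) → (Fin n → Fin n → Bool) → ℕ
countPairs n a =
  sum (map (λ p → if (toℕ (proj₁ p) <ᵇ toℕ (proj₂ p)) ∧ a (proj₁ p) (proj₂ p)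
                  then 1 else 0)
           (cartesianProduct (allFin n) (allFin n)))

edgeCount : {n : ℕ} → Graph n → ℕ
edgeCount {n} G = countPairs n (adj G)

-- Turán graph T_r(n): vertex i lies in part (i mod r); parts have sizes
-- ⌊n/r⌋ or ⌈n/r⌉; two vertices are adjacent iff they lie in different parts.

private
  modᵇ : ℕ → ℕ → ℕ   -- i mod (suc k), by simple recursion
  modᵇ k zero = zero
  modᵇ k (suc i) with modᵇ k i
  ... | m = if m ≡ᵇ k then zero else suc m

turanAdj : (k n : ℕ) → Fin n → Fin n → Bool
turanAdj k n i j = not (modᵇ k (toℕ i) ≡ᵇ modᵇ k (toℕ j))

turanNumber : (r n : ℕ) → ℕ
turanNumber zero n = 0
turanNumber (suc k) n = countPairs n (turanAdj k n)

kPlusAdj : (r s : ℕ) → Fin r × Fin s → Fin r × Fin s → Bool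
kPlusAdj r s (i , a) (j , b) =
  not (toℕ i ≡ᵇ toℕ j)
  ∨ ((toℕ i ≡ᵇ 0) ∧ (toℕ j ≡ᵇ 0)
     ∧ (((toℕ a ≡ᵇ 0) ∧ (toℕ b ≡ᵇ 1)) ∨ ((toℕ a ≡ᵇ 1) ∧ (toℕ b ≡ᵇ 0))))

ContainsKPlus : {n : ℕ} → Graph n → (r s : ℕ) → Set
ContainsKPlus {n} G r s =
  Σ (Fin r × Fin s → Fin n) λ f →
    Injective _≡_ _≡_ f ×
    (∀ u v → kPlusAdj r s u v ≡ true → adj G (f u) (f v) ≡ true)

-- Real exponential comparisons without reals.
-- expScaled k N = N! * Σ_{j ≤ N} k^j / j!   (a natural number)
expScaled : ℕ → ℕ → ℕ
expScaled k zero    = 1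
expScaled k (suc N) = suc N * expScaled k N + k ^ suc N

-- ExpLe k n  ⟺  e^k ≤ n   (the partial sums Σ_{j≤N} k^j/j! increase to e^k)
ExpLe : ℕ → ℕ → Set
ExpLe k n = ∀ N → expScaled k N ≤ n * (N !)

{-# OPTIONS --safe #-}
-- In terms of non-edges: let nonEdges W count the ordered pairs of non-adjacent (possibly equal) vertices
-- of W, and samePart the same number for the Turán graph, so that the hypothesis reads
-- nonEdges < samePart. Put Q = 4 r − 1.
--
-- Deleting vertices with more than 4 |W| / Q non-neighbours increases the surplus
-- samePart − nonEdges linearly in |W|, so the process stops while m = |W| is still of order n / r, with
-- at most 4 m / Q non-neighbours at every vertex. By Turán's theorem W contains a clique K on r + 1
-- vertices. A positive proportion of the vertices of W is adjacent to at least r vertices of K; passing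
-- to the neighbourhoods of these vertices and inducting on r, some edge uv of K lies in about m^(r−1)
-- cliques of size r + 1. By the degree condition, the r − 1 other vertices of such a clique have at least
-- 3 m / Q common neighbours y. This gives at least (r + 1) m^r / L tuples (y , x₁ , … , xᵣ₋₁), L = r^(r+7).
--
-- Among so many cliques one finds a blow-up by induction on the size of the cliques: take p cliques of
-- size one less having many extensions and forming a blow-up. Many vertices y extend at least
-- q = p / (2 L) of them, and since there are only 2^p possible subsets, q of the y extend the same ones.
-- Starting with p about log n leaves q ≥ c ln n. The vertices u and v complete the part of the y.
module Submission where

open import Defs hiding (sym)
open import Data.Bool using (Bool; true; false; not; _∧_; _∨_; if_then_else_)
open import Data.Bool.Properties using (T-≡; not-involutive)
open import Data.Fin using (Fin; zero; suc; toℕ; inject≤)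
import Data.Fin.Properties as Fin
open import Data.List using (List; []; _∷_; _++_; length; lookup; map; take; filterᵇ; replicate; zipWith; tabulate; allFin; cartesianProductWith)
open import Data.List.Membership.Propositional using (_∈_; find; lose)
open import Data.List.Membership.Propositional.Properties using (∈-∃++; ∈-++⁻; ∈-map⁻; ∈-lookup; ∈-filter⁺; ∈-filter⁻; ∈-cartesianProductWith⁻)
open import Data.List.Properties using (length-++; length-map; length-take; length-replicate; length-zipWith; length-tabulate)
open import Data.List.Relation.Binary.Permutation.Propositional using (_↭_; refl; prep; swap; trans; ↭⇒↭ₛ)
open import Data.List.Relation.Binary.Permutation.Propositional.Properties using (shift; ↭-length)
import Data.List.Relation.Binary.Permutation.Setoid.Properties as PermutationSetoid
open import Data.List.Relation.Unary.All as All using (All; []; _∷_)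
import Data.List.Relation.Unary.All.Properties as All
open import Data.List.Relation.Unary.AllPairs as AllPairs using (AllPairs; []; _∷_)
import Data.List.Relation.Unary.AllPairs.Properties as AllPairs
open import Data.List.Relation.Unary.Any using (here; there; any?)
open import Data.List.Relation.Unary.Unique.Propositional using (Unique)
open import Data.List.Relation.Unary.Unique.Propositional.Properties using (allFin⁺)
open import Data.Nat
open import Data.Nat.DivMod using (_/_; m/n*n≤m; m*n/n≡m; n/1≡n; m/n≤m; /-monoˡ-≤; /-monoʳ-≤)
open import Data.Nat.ListAction using (sum)
open import Data.Nat.Properties
open import Data.Nat.Tactic.RingSolver using (solve-∀)
open import Data.Product using (_×_; _,_; ∃; Σ; proj₁; proj₂)
open import Data.Sum using (inj₁; inj₂)
open import Data.Unit using (⊤; tt)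
open import Data.Vec as Vec using (Vec; []; _∷_)
open import Data.Vec.Relation.Binary.Pointwise.Inductive as Pointwise using (Pointwise; []; _∷_)
import Data.Vec.Relation.Unary.All as VecAll
import Data.Vec.Relation.Unary.All.Properties as VecAll
open import Function using (_∘_)
open import Function.Bundles using (Equivalence)
open import Relation.Binary.Definitions using (tri<; tri≈; tri>)
open import Relation.Binary.PropositionalEquality as ≡ using (_≡_; _≢_; refl; cong; cong₂; sym; subst; setoid)
open import Relation.Nullary using (¬_; contradiction; yes; no; does)
open import Relation.Nullary.Decidable using (T?; dec-true)

-- Sums and counting over lists

⟦_⟧ : Bool → ℕ
⟦ true ⟧  = 1
⟦ false ⟧ = 0

∑ : {A : Set} → List A → (A → ℕ) → ℕ
∑ []       f = 0
∑ (x ∷ xs) f = f x + ∑ xs f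

♯ : {A : Set} → (A → Bool) → List A → ℕ
♯ p xs = ∑ xs (λ x → ⟦ p x ⟧)

∑-mono : {A : Set} (xs : List A) {f g : A → ℕ} → (∀ {x} → x ∈ xs → f x ≤ g x) → ∑ xs f ≤ ∑ xs g
∑-mono []       h = z≤n
∑-mono (x ∷ xs) h = +-mono-≤ (h (here refl)) (∑-mono xs (h ∘ there))

∑-cong : {A : Set} (xs : List A) {f g : A → ℕ} → (∀ x → f x ≡ g x) → ∑ xs f ≡ ∑ xs g
∑-cong []       h = refl
∑-cong (x ∷ xs) h = cong₂ _+_ (h x) (∑-cong xs h)

∑-const : {A : Set} (xs : List A) (c : ℕ) → ∑ xs (λ _ → c) ≡ length xs * c
∑-const []       c = refl
∑-const (x ∷ xs) c = cong (c +_) (∑-const xs c)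

∑-zero : {A : Set} (xs : List A) → ∑ xs (λ _ → 0) ≡ 0
∑-zero xs = ≡.trans (∑-const xs 0) (*-zeroʳ (length xs))

interchange : ∀ a b c d → (a + b) + (c + d) ≡ (a + c) + (b + d)
interchange = solve-∀

∑-+ : {A : Set} (xs : List A) (f g : A → ℕ) → ∑ xs (λ x → f x + g x) ≡ ∑ xs f + ∑ xs g
∑-+ []       f g = refl
∑-+ (x ∷ xs) f g =
  ≡.trans (cong (f x + g x +_) (∑-+ xs f g)) (interchange (f x) (g x) (∑ xs f) (∑ xs g))

∑-*ˡ : {A : Set} (xs : List A) (c : ℕ) (f : A → ℕ) → ∑ xs (λ x → c * f x) ≡ c * ∑ xs f
∑-*ˡ []       c f = sym (*-zeroʳ c)
∑-*ˡ (x ∷ xs) c f =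
  ≡.trans (cong (c * f x +_) (∑-*ˡ xs c f)) (sym (*-distribˡ-+ c (f x) (∑ xs f)))

∑-swap : {A B : Set} (xs : List A) (ys : List B) (f : A → B → ℕ) →
  ∑ xs (λ x → ∑ ys (f x)) ≡ ∑ ys (λ y → ∑ xs (λ x → f x y))
∑-swap []       ys f = sym (∑-zero ys)
∑-swap (x ∷ xs) ys f =
  ≡.trans (cong (∑ ys (f x) +_) (∑-swap xs ys f)) (sym (∑-+ ys (f x) (λ y → ∑ xs (λ x → f x y))))

∑-++ : {A : Set} (xs ys : List A) (f : A → ℕ) → ∑ (xs ++ ys) f ≡ ∑ xs f + ∑ ys f
∑-++ []       ys f = refl
∑-++ (x ∷ xs) ys f = ≡.trans (cong (f x +_) (∑-++ xs ys f)) (sym (+-assoc (f x) _ _))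

∑-map : {A B : Set} (h : A → B) (xs : List A) (f : B → ℕ) → ∑ (map h xs) f ≡ ∑ xs (f ∘ h)
∑-map h []       f = refl
∑-map h (x ∷ xs) f = cong (f (h x) +_) (∑-map h xs f)

x+[y+z]≡y+[x+z] : ∀ x y z → x + (y + z) ≡ y + (x + z)
x+[y+z]≡y+[x+z] = solve-∀

∑-↭ : {A : Set} {xs ys : List A} (f : A → ℕ) → xs ↭ ys → ∑ xs f ≡ ∑ ys f
∑-↭ f refl          = refl
∑-↭ f (prep x p)    = cong (f x +_) (∑-↭ f p)
∑-↭ {xs = _ ∷ _ ∷ xs} f (swap x y p) =
  ≡.trans (x+[y+z]≡y+[x+z] (f x) (f y) (∑ xs f)) (cong (λ z → f y + (f x + z)) (∑-↭ f p))
∑-↭ f (trans p q)   = ≡.trans (∑-↭ f p) (∑-↭ f q)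

∑-filter : {A : Set} (p : A → Bool) (xs : List A) (f : A → ℕ) →
  ∑ (filterᵇ p xs) f ≡ ∑ xs (λ x → ⟦ p x ⟧ * f x)
∑-filter p []       f = refl
∑-filter p (x ∷ xs) f with p x
... | true  = cong₂ _+_ (sym (+-identityʳ (f x))) (∑-filter p xs f)
... | false = ∑-filter p xs f

∑-filter-split : {A : Set} (p : A → Bool) (xs : List A) (f : A → ℕ) →
  ∑ xs f ≡ ∑ (filterᵇ p xs) f + ∑ (filterᵇ (not ∘ p) xs) f
∑-filter-split p []       f = refl
∑-filter-split p (x ∷ xs) f with p x
... | true  = ≡.trans (cong (f x +_) (∑-filter-split p xs f)) (sym (+-assoc (f x) _ _))
... | false = ≡.trans (cong (f x +_) (∑-filter-split p xs f)) (x+[y+z]≡y+[x+z] (f x) (∑ (filterᵇ p xs) f) _)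

length-filter : {A : Set} (p : A → Bool) (xs : List A) → length (filterᵇ p xs) ≡ ♯ p xs
length-filter p []       = refl
length-filter p (x ∷ xs) with p x
... | true  = cong suc (length-filter p xs)
... | false = length-filter p xs

♯-not : {A : Set} (p : A → Bool) (xs : List A) → ♯ p xs + ♯ (not ∘ p) xs ≡ length xs
♯-not p []       = refl
♯-not p (x ∷ xs) with p x
... | true  = cong suc (♯-not p xs)
... | false = ≡.trans (+-suc _ _) (cong suc (♯-not p xs))

♯≤length : {A : Set} (p : A → Bool) (xs : List A) → ♯ p xs ≤ length xs
♯≤length p xs = subst (♯ p xs ≤_) (♯-not p xs) (m≤m+n _ _)

∑-filter-≤ : {A : Set} (p : A → Bool) (xs : List A) (f : A → ℕ) → ∑ (filterᵇ p xs) f ≤ ∑ xs f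
∑-filter-≤ p xs f = subst (∑ (filterᵇ p xs) f ≤_) (sym (∑-filter-split p xs f)) (m≤m+n _ _)

filter-comm : {A : Set} (p q : A → Bool) (xs : List A) →
  filterᵇ p (filterᵇ q xs) ≡ filterᵇ q (filterᵇ p xs)
filter-comm p q [] = refl
filter-comm p q (x ∷ xs) with p x in px | q x in qx
... | true  | true  rewrite px | qx = cong (x ∷_) (filter-comm p q xs)
... | true  | false rewrite qx = filter-comm p q xs
... | false | true  rewrite px = filter-comm p q xs
... | false | false = filter-comm p q xs

∈-filterᵇ⁻ : {A : Set} (p : A → Bool) {xs : List A} {x : A} → x ∈ filterᵇ p xs → x ∈ xs × p x ≡ true
∈-filterᵇ⁻ p {xs} x∈ with ∈-filter⁻ (T? ∘ p) {xs = xs} x∈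
... | x∈xs , px = x∈xs , Equivalence.to T-≡ px

∈-filterᵇ⁺ : {A : Set} (p : A → Bool) {xs : List A} {x : A} → x ∈ xs → p x ≡ true → x ∈ filterᵇ p xs
∈-filterᵇ⁺ p x∈xs px = ∈-filter⁺ (T? ∘ p) x∈xs (Equivalence.from T-≡ px)

♯-positive : {A : Set} (p : A → Bool) (xs : List A) → 0 < ♯ p xs → ∃ λ x → x ∈ xs × p x ≡ true
♯-positive p (x ∷ xs) h with p x in px
... | true  = x , here refl , px
... | false with ♯-positive p xs h
...   | y , y∈ , py = y , there y∈ , py

argmin : {A : Set} (f : A → ℕ) (x : A) (xs : List A) →
  ∃ λ z → z ∈ x ∷ xs × (∀ {y} → y ∈ x ∷ xs → f z ≤ f y)
argmin f x [] = x , here refl , λ { (here refl) → ≤-refl }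
argmin f x (y ∷ ys) with argmin f y ys
... | z , z∈ , min with ≤-total (f x) (f z)
...   | inj₁ x≤z = x , here refl , λ { (here refl) → ≤-refl ; (there y∈) → ≤-trans x≤z (min y∈) }
...   | inj₂ z≤x = z , there z∈ , λ { (here refl) → z≤x ; (there y∈) → min y∈ }

≤ᵇ-true : ∀ {m n} → (m ≤ᵇ n) ≡ true → m ≤ n
≤ᵇ-true {m} {n} e = ≤ᵇ⇒≤ m n (Equivalence.from T-≡ e)

≤ᵇ-false : ∀ {m n} → (m ≤ᵇ n) ≡ false → n < m
≤ᵇ-false e = ≰⇒> λ m≤n → contradiction (≡.trans (sym (Equivalence.to T-≡ (≤⇒≤ᵇ m≤n))) e) λ ()

-- Turán's theorem

-- The number of ordered pairs (i , j) with i ≡ j modulo suc k and i, j < m; equality is allowed.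
samePart : ℕ → ℕ → ℕ
samePart k zero    = 0
samePart k (suc m) = samePart k m + suc (2 * (m / suc k))

suc-square : ∀ x → x * x + suc (2 * x) ≡ suc x * suc x
suc-square = solve-∀

-- The right side belongs to a partition with one part of size x and the other d vertices split
-- evenly; balancing all parts minimises this count. The induction removes a vertex from the single
-- part if its size exceeds the quotient q, and otherwise from the rest, whose quotient is then at
-- least q.
samePart-convex : ∀ k d x → samePart (suc k) (d + x) ≤ samePart k d + x * x
samePart-convex k zero zero = z≤n
samePart-convex k zero (suc x) = begin
  samePart (suc k) x + suc (2 * (x / suc (suc k))) ≤⟨ +-mono-≤ (samePart-convex k zero x) (s≤s (*-monoʳ-≤ 2 (m/n≤m x (2 + k)))) ⟩
  x * x + suc (2 * x)                              ≡⟨ suc-square x ⟩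
  suc x * suc x                                    ∎
  where open ≤-Reasoning
samePart-convex k (suc d) zero = begin
  samePart (suc k) (d + 0) + suc (2 * ((d + 0) / suc (suc k)))
    ≤⟨ +-mono-≤ (samePart-convex k d zero) (s≤s (*-monoʳ-≤ 2 (/-monoʳ-≤ (d + 0) (n≤1+n (suc k))))) ⟩
  samePart k d + 0 + suc (2 * ((d + 0) / suc k))
    ≡⟨ cong₂ (λ u v → u + suc (2 * (v / suc k))) (+-identityʳ (samePart k d)) (+-identityʳ d) ⟩
  samePart k d + suc (2 * (d / suc k))
    ≡⟨ sym (+-identityʳ _) ⟩
  samePart k d + suc (2 * (d / suc k)) + 0 ∎
  where open ≤-Reasoning
samePart-convex k (suc d) (suc x) with (d + suc x) / suc (suc k) ≤? x
... | yes q≤x = begin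
  samePart (suc k) (d + suc x) + suc (2 * q) ≡⟨ cong (λ z → samePart (suc k) z + suc (2 * q)) (+-suc d x) ⟩
  samePart (suc k) (suc d + x) + suc (2 * q) ≤⟨ +-mono-≤ (samePart-convex k (suc d) x) (s≤s (*-monoʳ-≤ 2 q≤x)) ⟩
  samePart k (suc d) + x * x + suc (2 * x)   ≡⟨ +-assoc (samePart k (suc d)) (x * x) _ ⟩
  samePart k (suc d) + (x * x + suc (2 * x)) ≡⟨ cong (samePart k (suc d) +_) (suc-square x) ⟩
  samePart k (suc d) + suc x * suc x         ∎
  where
  open ≤-Reasoning
  q = (d + suc x) / suc (suc k)
... | no q≰x = begin
  samePart (suc k) (d + suc x) + suc (2 * q)            ≤⟨ +-mono-≤ (samePart-convex k d (suc x)) (s≤s (*-monoʳ-≤ 2 q≤d/k)) ⟩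
  samePart k d + suc x * suc x + suc (2 * (d / suc k))  ≡⟨ swap₂₃ (samePart k d) (suc x * suc x) _ ⟩
  samePart k d + suc (2 * (d / suc k)) + suc x * suc x  ∎
  where
  open ≤-Reasoning
  q = (d + suc x) / suc (suc k)
  swap₂₃ : ∀ u v w → u + v + w ≡ u + w + v
  swap₂₃ = solve-∀
  q≤d/k : q ≤ d / suc k
  q≤d/k = subst (_≤ d / suc k) (m*n/n≡m q (suc k)) (/-monoˡ-≤ (suc k) (+-cancelʳ-≤ (suc x) _ _ (begin
    q * suc k + suc x ≤⟨ +-monoʳ-≤ (q * suc k) (≰⇒> q≰x) ⟩
    q * suc k + q     ≡⟨ ≡.trans (+-comm (q * suc k) q) (sym (*-suc q (suc k))) ⟩
    q * suc (suc k)   ≤⟨ m/n*n≤m (d + suc x) (2 + k) ⟩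
    d + suc x         ∎)))

samePart-0 : ∀ m → samePart 0 m ≡ m * m
samePart-0 zero = refl
samePart-0 (suc m) = ≡.trans (cong₂ (λ u v → u + suc (2 * v)) (samePart-0 m) (n/1≡n m)) (suc-square m)

-- Each step adds 2 (m / r) + 1, where r (m / r) ≤ m. This quadratic bound is what stops the
-- deletion process.
samePart-upper : ∀ k m → suc k * samePart k m ≤ suc k * m + m * m
samePart-upper k zero = m≤m+n (suc k * 0) 0
samePart-upper k (suc m) = begin
  suc k * (samePart k m + suc (2 * (m / suc k)))            ≡⟨ expand (suc k) (samePart k m) (m / suc k) ⟩
  suc k * samePart k m + suc k + 2 * (m / suc k * suc k)    ≤⟨ +-mono-≤ (+-monoˡ-≤ (suc k) (samePart-upper k m)) (*-monoʳ-≤ 2 (m/n*n≤m m (suc k))) ⟩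
  suc k * m + m * m + suc k + 2 * m                         ≤⟨ m≤m+n _ 1 ⟩
  suc k * m + m * m + suc k + 2 * m + 1                     ≡⟨ collect (suc k) m ⟩
  suc k * suc m + suc m * suc m                             ∎
  where
  open ≤-Reasoning
  expand : ∀ r s q → r * (s + suc (2 * q)) ≡ r * s + r + 2 * (q * r)
  expand = solve-∀
  collect : ∀ r m → r * m + m * m + r + 2 * m + 1 ≡ r * suc m + suc m * suc m
  collect = solve-∀

module Counting {A : Set} (a : A → A → Bool) where

  Adj : A → A → Set
  Adj x y = a x y ≡ true

  nonDegree : List A → A → ℕ
  nonDegree W x = ♯ (not ∘ a x) W

  nonEdges : List A → ℕ
  nonEdges W = ∑ W (nonDegree W)

  nbhd : A → List A → List A
  nbhd x = filterᵇ (a x)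

  nonDegree-filter : ∀ p W x → nonDegree (filterᵇ p W) x ≤ nonDegree W x
  nonDegree-filter p W x = ∑-filter-≤ p W _

  length-nbhd : ∀ x W → length (nbhd x W) + nonDegree W x ≡ length W
  length-nbhd x W = ≡.trans (cong (_+ nonDegree W x) (length-filter (a x) W)) (♯-not (a x) W)

  record Clique (k : ℕ) (W : List A) : Set where
    constructor clique
    field
      vertices : List A
      size     : length vertices ≡ k
      adjacent : AllPairs Adj vertices
      inside   : ∀ {x} → x ∈ vertices → x ∈ W

  -- Take x with the fewest non-neighbours, nd in number, and pass to its neighbourhood. This
  -- discards at least nd² non-edges, while `samePart` falls by at most nd² by `samePart-convex`; so
  -- the surplus stays positive with one part fewer.
  turán : ∀ k W → nonEdges W < samePart k (length W) → Clique (2 + k) W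
  turán k [] ()
  turán k (w ∷ ws) dense with argmin (nonDegree (w ∷ ws)) w ws
  turán zero W@(w ∷ ws) dense | x , x∈W , minimal
    -- With a single part `samePart` is |W|², so the minimal non-degree is below |W| and x has a
    -- neighbour.
    with ♯-positive (a x) W (+-cancelʳ-< (nonDegree W x) 0 _ nd<)
    where
    nd< : nonDegree W x < ♯ (a x) W + nonDegree W x
    nd< = *-cancelˡ-< (length W) _ _ (begin-strict
      length W * nonDegree W x       ≡⟨ sym (∑-const W _) ⟩
      ∑ W (λ _ → nonDegree W x)      ≤⟨ ∑-mono W minimal ⟩
      nonEdges W                     <⟨ dense ⟩
      samePart 0 (length W)          ≡⟨ samePart-0 (length W) ⟩
      length W * length W            ≡⟨ cong (length W *_) (sym (♯-not (a x) W)) ⟩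
      length W * (♯ (a x) W + nonDegree W x) ∎)
      where open ≤-Reasoning
  ... | y , y∈W , xy = clique (x ∷ y ∷ []) refl ((xy ∷ []) ∷ [] ∷ []) λ { (here refl) → x∈W ; (there (here refl)) → y∈W }
  turán (suc k) W@(w ∷ ws) dense | x , x∈W , minimal = extend (turán k N N-dense)
    where
    open ≤-Reasoning
    N = nbhd x W
    M = filterᵇ (not ∘ a x) W
    nd = nonDegree W x

    -- Each vertex of M has at least |M| non-neighbours, by the choice of x.
    split : nonEdges N + nd * nd ≤ nonEdges W
    split = begin
      nonEdges N + nd * nd                            ≡⟨ cong (λ z → nonEdges N + z * nd) (sym (length-filter (not ∘ a x) W)) ⟩
      nonEdges N + length M * nd                      ≡⟨ cong (nonEdges N +_) (sym (∑-const M nd)) ⟩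
      nonEdges N + ∑ M (λ _ → nd)                     ≤⟨ +-mono-≤ (∑-mono N (λ {y} _ → nonDegree-filter (a x) W y)) (∑-mono M (λ y∈M → minimal (proj₁ (∈-filterᵇ⁻ (not ∘ a x) y∈M)))) ⟩
      ∑ N (nonDegree W) + ∑ M (nonDegree W)           ≡⟨ sym (∑-filter-split (a x) W (nonDegree W)) ⟩
      nonEdges W                                      ∎

    N-dense : nonEdges N < samePart k (length N)
    N-dense = +-cancelʳ-< (nd * nd) _ _ (begin-strict
      nonEdges N + nd * nd               ≤⟨ split ⟩
      nonEdges W                         <⟨ dense ⟩
      samePart (suc k) (length W)        ≡⟨ cong (samePart (suc k)) (sym (length-nbhd x W)) ⟩
      samePart (suc k) (length N + nd)   ≤⟨ samePart-convex k (length N) nd ⟩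
      samePart k (length N) + nd * nd    ∎)

    extend : Clique (2 + k) N → Clique (3 + k) W
    extend (clique K size adj inside) =
      clique (x ∷ K) (cong suc size)
        (All.tabulate (λ y∈K → proj₂ (∈-filterᵇ⁻ (a x) (inside y∈K))) ∷ adj)
        λ { (here refl) → x∈W ; (there y∈K) → proj₁ (∈-filterᵇ⁻ (a x) (inside y∈K)) }

-- Deleting vertices of small degree

module Deletion {A : Set} (a : A → A → Bool)
  (a-sym : ∀ x y → a x y ≡ a y x) (a-irrefl : ∀ x → a x x ≡ false) where
  open Counting a

  nonDegree-self : ∀ x W → nonDegree (x ∷ W) x ≡ suc (nonDegree W x)
  nonDegree-self x W rewrite a-irrefl x = refl

  -- By irreflexivity x is its own non-neighbour, whence the 1; by symmetry the other non-neighbours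
  -- count twice. The increments of `samePart` have the same shape.
  nonEdges-∷ : ∀ x W → nonEdges (x ∷ W) ≡ suc (2 * nonDegree W x) + nonEdges W
  nonEdges-∷ x W = begin
    nonDegree (x ∷ W) x + ∑ W (λ y → ⟦ not (a y x) ⟧ + nonDegree W y)
      ≡⟨ cong₂ _+_ (nonDegree-self x W) (∑-+ W _ _) ⟩
    suc (nonDegree W x) + (∑ W (λ y → ⟦ not (a y x) ⟧) + nonEdges W)
      ≡⟨ cong (λ z → suc (nonDegree W x) + (z + nonEdges W)) (∑-cong W (λ y → cong (⟦_⟧ ∘ not) (a-sym y x))) ⟩
    suc (nonDegree W x) + (nonDegree W x + nonEdges W)
      ≡⟨ collect (nonDegree W x) (nonEdges W) ⟩
    suc (2 * nonDegree W x) + nonEdges W ∎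
    where
    open ≡.≡-Reasoning
    collect : ∀ u v → suc u + (u + v) ≡ suc (2 * u) + v
    collect = solve-∀

  nonEdges-↭ : ∀ {W W′} → W ↭ W′ → nonEdges W ≡ nonEdges W′
  nonEdges-↭ {W} {W′} p = ≡.trans (∑-cong W (λ x → ∑-↭ _ p)) (∑-↭ _ p)

  remove : ∀ {x : A} {W : List A} → x ∈ W → ∃ λ W′ → W ↭ x ∷ W′
  remove {x} x∈W with ∈-∃++ x∈W
  ... | ys , zs , refl = ys ++ zs , shift x ys zs

  -- The factor in `minDegree` is Q = 4 r - 1. The threshold 4 / Q lies slightly above 1 / r, the
  -- share of non-neighbours in a balanced Turán graph; this gap is the gain of a deletion.
  record DenseSubset (k m₀ : ℕ) : Set where
    constructor denseSubset
    field
      support   : List A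
      unique    : Unique support
      large     : m₀ ≤ length support
      dense     : nonEdges support < samePart k (length support)
      minDegree : ∀ {x} → x ∈ support → (3 + 4 * k) * nonDegree support x ≤ 4 * length support

  -- Deleting a vertex of small degree increases samePart − nonEdges by at least m₀ / (r Q), where
  -- r = suc k and Q = 4 r − 1. As samePart is at most quadratic, this cannot go on for J steps.
  module _ (k m₀ J : ℕ)
    (m₀-large : 2 * (suc k * (3 + 4 * k)) ≤ m₀) (J-large : 2 * (3 + 4 * k) * m₀ ≤ J) where

    private
      r = suc k
      Q = 3 + 4 * k

      -- Since 4 r = Q + 1, sparseness multiplied by 2 r yields 2 Q m + 2 m. One spare m covers m₀,
      -- the other the 2 r Q lost in passing from d + 1 to d.
      gain : ∀ m d → m₀ ≤ m → 4 * suc m < Q * suc d →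
        2 * (r * Q * (m / r)) + m₀ ≤ 2 * (r * Q * d)
      gain m d m₀≤m sparse = +-cancelʳ-≤ (2 * (r * Q)) _ _ (begin
        2 * (r * Q * (m / r)) + m₀ + 2 * (r * Q)   ≤⟨ +-mono-≤ (+-mono-≤ (≤-reflexive (commute r Q (m / r))) m₀≤m) (≤-trans m₀-large m₀≤m) ⟩
        2 * (Q * (m / r * r)) + m + m              ≤⟨ +-monoˡ-≤ m (+-monoˡ-≤ m (*-monoʳ-≤ 2 (*-monoʳ-≤ Q (m/n*n≤m m r)))) ⟩
        2 * (Q * m) + m + m                        ≤⟨ m≤m+n _ (8 * r) ⟩
        2 * (Q * m) + m + m + 8 * r                ≡⟨ combine k m ⟩
        2 * (r * (4 * suc m))                      ≤⟨ *-monoʳ-≤ 2 (*-monoʳ-≤ r (<⇒≤ sparse)) ⟩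
        2 * (r * (Q * suc d))                      ≡⟨ expand r Q d ⟩
        2 * (r * Q * d) + 2 * (r * Q)              ∎)
        where
        open ≤-Reasoning
        commute : ∀ r Q q → 2 * (r * Q * q) ≡ 2 * (Q * (q * r))
        commute = solve-∀
        combine : ∀ k m → 2 * ((3 + 4 * k) * m) + m + m + 8 * suc k ≡ 2 * (suc k * (4 * suc m))
        combine = solve-∀
        expand : ∀ r Q d → 2 * (r * (Q * suc d)) ≡ 2 * (r * Q * d) + 2 * (r * Q)
        expand = solve-∀

      r≤m₀ : r ≤ m₀
      r≤m₀ = begin
        r             ≤⟨ m≤m*n r Q ⟩
        r * Q         ≤⟨ m≤n*m (r * Q) 2 ⟩
        2 * (r * Q)   ≤⟨ m₀-large ⟩
        m₀            ∎
        where open ≤-Reasoning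

      -- After J deletions the scaled surplus would exceed J m₀ on m₀ vertices, but r Q `samePart` k
      -- m₀ ≤ 2 Q m₀² ≤ J m₀.
      exhausted : ∀ N → ¬ (r * Q * N + J * m₀ < r * Q * samePart k m₀ + 0 * m₀)
      exhausted N lt = <-irrefl refl (begin-strict
        J * m₀                          ≤⟨ m≤n+m _ _ ⟩
        r * Q * N + J * m₀              <⟨ lt ⟩
        r * Q * samePart k m₀ + 0       ≡⟨ commute r Q (samePart k m₀) ⟩
        Q * (r * samePart k m₀)         ≤⟨ *-monoʳ-≤ Q (samePart-upper k m₀) ⟩
        Q * (r * m₀ + m₀ * m₀)          ≤⟨ *-monoʳ-≤ Q (+-monoˡ-≤ (m₀ * m₀) (*-monoˡ-≤ m₀ r≤m₀)) ⟩
        Q * (m₀ * m₀ + m₀ * m₀)         ≡⟨ collect Q m₀ ⟩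
        2 * Q * m₀ * m₀                 ≤⟨ *-monoˡ-≤ m₀ J-large ⟩
        J * m₀                          ∎)
        where
        open ≤-Reasoning
        commute : ∀ r Q z → r * Q * z + 0 ≡ Q * (r * z)
        commute = solve-∀
        collect : ∀ Q m → Q * (m * m + m * m) ≡ 2 * Q * m * m
        collect = solve-∀

    -- Here j deletions are still allowed. The last hypothesis is the invariant r Q (`samePart` -
    -- `nonEdges`) > (J - j) m₀ written without subtraction; `gain` preserves it.
    deleteSparse : ∀ j W → length W ≡ j + m₀ → Unique W → j ≤ J →
      r * Q * nonEdges W + J * m₀ < r * Q * samePart k (length W) + j * m₀ → DenseSubset k m₀
    deleteSparse j W |W| W! j≤J dense with any? (λ x → 4 * length W <? Q * nonDegree W x) W
    ... | no noneSparse = denseSubset W W! (subst (m₀ ≤_) (sym |W|) (m≤n+m m₀ j))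
            (*-cancelˡ-< (r * Q) _ _ (+-cancelʳ-< (J * m₀) _ _
              (<-≤-trans dense (+-monoʳ-≤ (r * Q * samePart k (length W)) (*-monoˡ-≤ m₀ j≤J)))))
            (λ x∈W → ≮⇒≥ (noneSparse ∘ lose x∈W))
    deleteSparse zero W |W| W! j≤J dense | yes _ =
      contradiction (subst (λ z → r * Q * nonEdges W + J * m₀ < r * Q * samePart k z + 0 * m₀) |W| dense) (exhausted (nonEdges W))
    deleteSparse (suc j) W |W| W! j≤J dense | yes someSparse with find someSparse
    ... | x , x∈W , sparse with remove x∈W
    ... | W′ , p = deleteSparse j W′ |W′| (W′-unique (PermutationSetoid.Unique-resp-↭ (setoid A) (↭⇒↭ₛ p) W!)) (≤-trans (n≤1+n j) j≤J) dense′
      where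
      W′-unique : Unique (x ∷ W′) → Unique W′
      W′-unique (_ ∷ u) = u

      |W|≡ : length W ≡ suc (length W′)
      |W|≡ = ↭-length p

      |W′| : length W′ ≡ j + m₀
      |W′| = suc-injective (≡.trans (sym |W|≡) |W|)

      m = length W′
      d = nonDegree W′ x

      g : 2 * (r * Q * (m / r)) + m₀ ≤ 2 * (r * Q * d)
      g = gain m d (subst (m₀ ≤_) (sym |W′|) (m≤n+m m₀ j))
        (≡.subst₂ _<_ (cong (4 *_) |W|≡) (cong (Q *_) (≡.trans (∑-↭ _ p) (nonDegree-self x W′))) sparse)

      dense′ : r * Q * nonEdges W′ + J * m₀ < r * Q * samePart k m + j * m₀
      dense′ = +-cancelʳ-< (r * Q + 2 * (r * Q * d)) _ _ (begin-strict
        r * Q * nonEdges W′ + J * m₀ + (r * Q + 2 * (r * Q * d))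
          ≡⟨ expand₁ (r * Q) (nonEdges W′) (J * m₀) d ⟩
        r * Q * (suc (2 * d) + nonEdges W′) + J * m₀
          ≡⟨ cong (λ z → r * Q * z + J * m₀) (sym (≡.trans (nonEdges-↭ p) (nonEdges-∷ x W′))) ⟩
        r * Q * nonEdges W + J * m₀
          <⟨ dense ⟩
        r * Q * samePart k (length W) + suc j * m₀
          ≡⟨ cong (λ z → r * Q * samePart k z + suc j * m₀) |W|≡ ⟩
        r * Q * (samePart k m + suc (2 * (m / r))) + (m₀ + j * m₀)
          ≡⟨ expand₂ (r * Q) (samePart k m) (m / r) m₀ (j * m₀) ⟩
        r * Q * samePart k m + j * m₀ + (r * Q + (2 * (r * Q * (m / r)) + m₀))
          ≤⟨ +-monoʳ-≤ (r * Q * samePart k m + j * m₀) (+-monoʳ-≤ (r * Q) g) ⟩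
        r * Q * samePart k m + j * m₀ + (r * Q + 2 * (r * Q * d)) ∎)
        where
        open ≤-Reasoning
        expand₁ : ∀ c N e d → c * N + e + (c + 2 * (c * d)) ≡ c * (suc (2 * d) + N) + e
        expand₁ = solve-∀
        expand₂ : ∀ c z q m f → c * (z + suc (2 * q)) + (m + f) ≡ c * z + f + (c + (2 * (c * q) + m))
        expand₂ = solve-∀

-- Many cliques on a common edge

average : {A : Set} (x : A) (xs : List A) (f : A → ℕ) →
  ∃ λ z → z ∈ x ∷ xs × ∑ (x ∷ xs) f ≤ length (x ∷ xs) * f z
average x [] f = x , here refl , ≤-refl
average x (y ∷ ys) f with average y ys f
... | z , z∈ , bound with ≤-total (f x) (f z)
...   | inj₁ x≤z = z , there z∈ , +-mono-≤ x≤z bound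
...   | inj₂ z≤x = x , here refl , +-monoʳ-≤ (f x) (≤-trans bound (*-monoʳ-≤ (length (y ∷ ys)) z≤x))

pairs : {A : Set} → List A → List (A × A)
pairs []       = []
pairs (x ∷ xs) = map (x ,_) xs ++ pairs xs

∑-pairs-∷ : {A : Set} (x : A) (xs : List A) (f : A × A → ℕ) →
  ∑ (pairs (x ∷ xs)) f ≡ ∑ xs (λ y → f (x , y)) + ∑ (pairs xs) f
∑-pairs-∷ x xs f = ≡.trans (∑-++ (map (x ,_) xs) (pairs xs) f) (cong (_+ ∑ (pairs xs) f) (∑-map (x ,_) xs f))

length-pairs : {A : Set} (xs : List A) → 2 * length (pairs xs) + length xs ≡ length xs * length xs
length-pairs [] = refl
length-pairs (x ∷ xs) = begin
  2 * length (map (x ,_) xs ++ pairs xs) + suc l   ≡⟨ cong (λ z → 2 * z + suc l) (≡.trans (length-++ (map (x ,_) xs)) (cong (_+ length (pairs xs)) (length-map (x ,_) xs))) ⟩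
  2 * (l + length (pairs xs)) + suc l              ≡⟨ rearrange l (length (pairs xs)) ⟩
  suc (2 * l + (2 * length (pairs xs) + l))        ≡⟨ cong (λ z → suc (2 * l + z)) (length-pairs xs) ⟩
  suc (2 * l + l * l)                              ≡⟨ square l ⟩
  suc l * suc l                                    ∎
  where
  open ≡.≡-Reasoning
  l = length xs
  rearrange : ∀ l p → 2 * (l + p) + suc l ≡ suc (2 * l + (2 * p + l))
  rearrange = solve-∀
  square : ∀ l → suc (2 * l + l * l) ≡ suc l * suc l
  square = solve-∀

∈-pairs : {A : Set} {R : A → A → Set} {xs : List A} → AllPairs R xs →
  ∀ {e} → e ∈ pairs xs → R (proj₁ e) (proj₂ e)
∈-pairs {xs = x ∷ xs} (x~ ∷ xs~) e∈ with ∈-++⁻ (map (x ,_) xs) e∈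
... | inj₂ e∈xs = ∈-pairs xs~ e∈xs
... | inj₁ e∈x with ∈-map⁻ (x ,_) e∈x
...   | y , y∈xs , refl = All.lookup x~ y∈xs

∑-pairs-filter : {A : Set} (p : A → Bool) (xs : List A) (f : A × A → ℕ) →
  ∑ (pairs xs) (λ e → ⟦ p (proj₁ e) ⟧ * (⟦ p (proj₂ e) ⟧ * f e)) ≡ ∑ (pairs (filterᵇ p xs)) f
∑-pairs-filter p [] f = refl
∑-pairs-filter p (x ∷ xs) f with p x in px
... | true = begin
  ∑ (pairs (x ∷ xs)) g                                          ≡⟨ ∑-pairs-∷ x xs g ⟩
  ∑ xs (λ y → ⟦ p x ⟧ * (⟦ p y ⟧ * f (x , y))) + ∑ (pairs xs) g  ≡⟨ cong₂ _+_ first (∑-pairs-filter p xs f) ⟩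
  ∑ xs′ (λ y → f (x , y)) + ∑ (pairs xs′) f                     ≡⟨ sym (∑-pairs-∷ x xs′ f) ⟩
  ∑ (pairs (x ∷ xs′)) f                                         ∎
  where
  open ≡.≡-Reasoning
  xs′ = filterᵇ p xs
  g = λ e → ⟦ p (proj₁ e) ⟧ * (⟦ p (proj₂ e) ⟧ * f e)
  first : ∑ xs (λ y → ⟦ p x ⟧ * (⟦ p y ⟧ * f (x , y))) ≡ ∑ xs′ (λ y → f (x , y))
  first = ≡.trans (∑-cong xs (λ y → ≡.trans (cong (λ b → ⟦ b ⟧ * (⟦ p y ⟧ * f (x , y))) px) (*-identityˡ _)))
                  (sym (∑-filter p xs _))
... | false = begin
  ∑ (pairs (x ∷ xs)) g                                          ≡⟨ ∑-pairs-∷ x xs g ⟩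
  ∑ xs (λ y → ⟦ p x ⟧ * (⟦ p y ⟧ * f (x , y))) + ∑ (pairs xs) g  ≡⟨ cong₂ _+_ first (∑-pairs-filter p xs f) ⟩
  ∑ (pairs (filterᵇ p xs)) f                                    ∎
  where
  open ≡.≡-Reasoning
  g = λ e → ⟦ p (proj₁ e) ⟧ * (⟦ p (proj₂ e) ⟧ * f e)
  first : ∑ xs (λ y → ⟦ p x ⟧ * (⟦ p y ⟧ * f (x , y))) ≡ 0
  first = ≡.trans (∑-cong xs (λ y → cong (λ b → ⟦ b ⟧ * (⟦ p y ⟧ * f (x , y))) px)) (∑-zero xs)

∑-take-≤ : {A : Set} (j : ℕ) (xs : List A) (f : A → ℕ) → ∑ (take j xs) f ≤ ∑ xs f
∑-take-≤ zero    xs       f = z≤n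
∑-take-≤ (suc j) []       f = z≤n
∑-take-≤ (suc j) (x ∷ xs) f = +-monoʳ-≤ (f x) (∑-take-≤ j xs f)

∑-pairs-take-≤ : {A : Set} (j : ℕ) (xs : List A) (f : A × A → ℕ) → ∑ (pairs (take j xs)) f ≤ ∑ (pairs xs) f
∑-pairs-take-≤ zero    xs       f = z≤n
∑-pairs-take-≤ (suc j) []       f = z≤n
∑-pairs-take-≤ (suc j) (x ∷ xs) f = begin
  ∑ (pairs (x ∷ take j xs)) f                                   ≡⟨ ∑-pairs-∷ x (take j xs) f ⟩
  ∑ (take j xs) (λ y → f (x , y)) + ∑ (pairs (take j xs)) f     ≤⟨ +-mono-≤ (∑-take-≤ j xs _) (∑-pairs-take-≤ j xs f) ⟩
  ∑ xs (λ y → f (x , y)) + ∑ (pairs xs) f                       ≡⟨ sym (∑-pairs-∷ x xs f) ⟩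
  ∑ (pairs (x ∷ xs)) f                                          ∎
  where open ≤-Reasoning

∈-take⁻ : {A : Set} (j : ℕ) {xs : List A} {x : A} → x ∈ take j xs → x ∈ xs
∈-take⁻ (suc j) {_ ∷ _} (here e)  = here e
∈-take⁻ (suc j) {_ ∷ _} (there x∈) = there (∈-take⁻ j x∈)

-- The double factorial (2 k - 1)!!, the product of the factors that `many-good` contributes to
-- `many-joints`.
oddFactorial : ℕ → ℕ
oddFactorial zero    = 1
oddFactorial (suc k) = suc (2 * k) * oddFactorial k

module Joints {A : Set} (a : A → A → Bool) (a-sym : ∀ x y → a x y ≡ a y x) where
  open Counting a

  cliques : ℕ → List A → ℕ
  cliques zero    U = 1
  cliques (suc j) U = ∑ U (λ x → cliques j (nbhd x U))

  -- A joint is a family of cliques sharing an edge. For an edge uv this counts the ordered j-tuples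
  -- of U completing it to a clique.
  joint : ℕ → List A → A × A → ℕ
  joint j U (u , v) = cliques j (nbhd v (nbhd u U))

  joint-suc : ∀ j U e → joint (suc j) U e ≡
    ∑ U (λ x → ⟦ a x (proj₁ e) ⟧ * (⟦ a x (proj₂ e) ⟧ * joint j (nbhd x U) e))
  joint-suc j U (u , v) = begin
    ∑ (nbhd v (nbhd u U)) (λ x → cliques j (nbhd x (nbhd v (nbhd u U))))
      ≡⟨ ∑-cong (nbhd v (nbhd u U)) (λ x → cong (cliques j)
           (≡.trans (filter-comm (a x) (a v) (nbhd u U)) (cong (nbhd v) (filter-comm (a x) (a u) U)))) ⟩
    ∑ (nbhd v (nbhd u U)) (λ x → joint j (nbhd x U) (u , v))
      ≡⟨ ∑-filter (a v) (nbhd u U) _ ⟩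
    ∑ (nbhd u U) (λ x → ⟦ a v x ⟧ * joint j (nbhd x U) (u , v))
      ≡⟨ ∑-filter (a u) U _ ⟩
    ∑ U (λ x → ⟦ a u x ⟧ * (⟦ a v x ⟧ * joint j (nbhd x U) (u , v)))
      ≡⟨ ∑-cong U (λ x → cong₂ (λ b c → ⟦ b ⟧ * (⟦ c ⟧ * joint j (nbhd x U) (u , v))) (a-sym u x) (a-sym v x)) ⟩
    ∑ U (λ x → ⟦ a x u ⟧ * (⟦ a x v ⟧ * joint j (nbhd x U) (u , v))) ∎
    where open ≡.≡-Reasoning

  -- Double counting by the first vertex x of the tuple: x sees both ends of the pair, so only pairs
  -- of neighbours of x in K remain. This is the same sum for the neighbourhoods of x, ready for
  -- induction.
  ∑-joint-suc : ∀ j U K → ∑ (pairs K) (joint (suc j) U) ≡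
    ∑ U (λ x → ∑ (pairs (nbhd x K)) (joint j (nbhd x U)))
  ∑-joint-suc j U K = ≡.trans (∑-cong (pairs K) (joint-suc j U))
    (≡.trans (∑-swap (pairs K) U _) (∑-cong U (λ x → ∑-pairs-filter (a x) K (joint j (nbhd x U)))))

  module _ (Q m : ℕ) where

    private
      good : ℕ → List A → A → Bool
      good k K x = 2 + k ≤ᵇ ♯ (a x) K

      bad⇒two-nonneighbours : ∀ k K x → length K ≡ 3 + k →
        2 * ⟦ not (good k K x) ⟧ ≤ ♯ (not ∘ a x) K
      bad⇒two-nonneighbours k K x |K| with good k K x in eq
      ... | true  = z≤n
      ... | false = +-cancelˡ-≤ (suc k) _ _ (begin
        suc k + 2                        ≡⟨ +-comm (suc k) 2 ⟩
        3 + k                            ≡⟨ sym |K| ⟩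
        length K                         ≡⟨ sym (♯-not (a x) K) ⟩
        ♯ (a x) K + ♯ (not ∘ a x) K      ≤⟨ +-monoˡ-≤ (♯ (not ∘ a x) K) (s≤s⁻¹ (≤ᵇ-false eq)) ⟩
        suc k + ♯ (not ∘ a x) K          ∎)
        where open ≤-Reasoning

      -- Count the non-adjacent pairs between U and K. Each of the k + 3 vertices of K is in at most
      -- 4 m / Q of them and each bad vertex in at least two, so at most (2 k + 6) m / Q of the (4 k
      -- + 7) m / Q vertices are bad.
      many-good : ∀ k U K → (∀ {x} → x ∈ U → Q * nonDegree U x ≤ 4 * m) →
        (3 + 4 * suc k) * m ≤ Q * length U → length K ≡ 3 + k → (∀ {x} → x ∈ K → x ∈ U) →
        suc (2 * k) * m ≤ Q * ♯ (good k K) U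
      many-good k U K deg large |K| K⊆U = +-cancelʳ-≤ (Q * ♯ (not ∘ good k K) U) _ _ (begin
        suc (2 * k) * m + Q * ♯ (not ∘ good k K) U    ≤⟨ +-monoʳ-≤ (suc (2 * k) * m) few-bad ⟩
        suc (2 * k) * m + 2 * ((3 + k) * m)           ≡⟨ collect k m ⟩
        (3 + 4 * suc k) * m                           ≤⟨ large ⟩
        Q * length U                                  ≡⟨ cong (Q *_) (sym (♯-not (good k K) U)) ⟩
        Q * (♯ (good k K) U + ♯ (not ∘ good k K) U)   ≡⟨ *-distribˡ-+ Q _ _ ⟩
        Q * ♯ (good k K) U + Q * ♯ (not ∘ good k K) U ∎)
        where
        open ≤-Reasoning
        collect : ∀ k m → suc (2 * k) * m + 2 * ((3 + k) * m) ≡ (3 + 4 * suc k) * m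
        collect = solve-∀
        commute : ∀ x y z → x * (y * z) ≡ y * (x * z)
        commute = solve-∀
        double : ∀ l m → l * (4 * m) ≡ 2 * (2 * (l * m))
        double = solve-∀
        few-bad : Q * ♯ (not ∘ good k K) U ≤ 2 * ((3 + k) * m)
        few-bad = *-cancelˡ-≤ 2 (begin
          2 * (Q * ♯ (not ∘ good k K) U)                  ≡⟨ commute 2 Q _ ⟩
          Q * (2 * ♯ (not ∘ good k K) U)                  ≡⟨ cong (Q *_) (sym (∑-*ˡ U 2 _)) ⟩
          Q * ∑ U (λ x → 2 * ⟦ not (good k K x) ⟧)        ≤⟨ *-monoʳ-≤ Q (∑-mono U (λ {x} _ → bad⇒two-nonneighbours k K x |K|)) ⟩
          Q * ∑ U (λ x → ♯ (not ∘ a x) K)                 ≡⟨ cong (Q *_) (∑-swap U K _) ⟩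
          Q * ∑ K (λ v → ∑ U (λ x → ⟦ not (a x v) ⟧))     ≡⟨ cong (Q *_) (∑-cong K (λ v → ∑-cong U (λ x → cong (⟦_⟧ ∘ not) (a-sym x v)))) ⟩
          Q * ∑ K (nonDegree U)                           ≡⟨ sym (∑-*ˡ K Q _) ⟩
          ∑ K (λ v → Q * nonDegree U v)                   ≤⟨ ∑-mono K (λ v∈K → deg (K⊆U v∈K)) ⟩
          ∑ K (λ _ → 4 * m)                               ≡⟨ ≡.trans (∑-const K (4 * m)) (cong (_* (4 * m)) |K|) ⟩
          (3 + k) * (4 * m)                               ≡⟨ double (3 + k) m ⟩
          2 * (2 * ((3 + k) * m))                         ∎)

    -- Induction through the neighbourhoods of good vertices. Q and m remain those of the initial
    -- set: non-degrees do not grow in a neighbourhood, and its size drops by at most 4 m / Q,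
    -- exactly what the bound on |U| allows per step.
    many-joints : ∀ k U K → (∀ {x} → x ∈ U → Q * nonDegree U x ≤ 4 * m) →
      (3 + 4 * k) * m ≤ Q * length U → length K ≡ 2 + k → (∀ {x} → x ∈ K → x ∈ U) →
      oddFactorial k * m ^ k ≤ Q ^ k * ∑ (pairs K) (joint k U)
    many-joints zero U (x ∷ y ∷ []) deg large refl K⊆U = ≤-refl
    many-joints (suc k) U K deg large |K| K⊆U = begin
      suc (2 * k) * oddFactorial k * (m * m ^ k)       ≡⟨ rearrange₁ (suc (2 * k)) (oddFactorial k) m (m ^ k) ⟩
      suc (2 * k) * m * (oddFactorial k * m ^ k)       ≤⟨ *-monoˡ-≤ (oddFactorial k * m ^ k) (many-good k U K deg large |K| K⊆U) ⟩
      Q * ♯ (good k K) U * (oddFactorial k * m ^ k)    ≡⟨ rearrange₂ Q (♯ (good k K) U) (oddFactorial k * m ^ k) ⟩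
      Q * (♯ (good k K) U * (oddFactorial k * m ^ k))  ≡⟨ cong (λ z → Q * (z * (oddFactorial k * m ^ k))) (sym (length-filter (good k K) U)) ⟩
      Q * (length G * (oddFactorial k * m ^ k))        ≡⟨ cong (Q *_) (sym (∑-const G _)) ⟩
      Q * ∑ G (λ _ → oddFactorial k * m ^ k)           ≤⟨ *-monoʳ-≤ Q (∑-mono G (λ x∈G → restrict (proj₁ (∈-filterᵇ⁻ (good k K) x∈G)) (proj₂ (∈-filterᵇ⁻ (good k K) {U} x∈G)))) ⟩
      Q * ∑ G (λ x → Q ^ k * S x)                      ≤⟨ *-monoʳ-≤ Q (∑-filter-≤ (good k K) U _) ⟩
      Q * ∑ U (λ x → Q ^ k * S x)                      ≡⟨ cong (Q *_) (∑-*ˡ U (Q ^ k) S) ⟩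
      Q * (Q ^ k * ∑ U S)                              ≡⟨ sym (*-assoc Q (Q ^ k) _) ⟩
      Q ^ suc k * ∑ U S                                ≡⟨ cong (Q ^ suc k *_) (sym (∑-joint-suc k U K)) ⟩
      Q ^ suc k * ∑ (pairs K) (joint (suc k) U)        ∎
      where
      open ≤-Reasoning
      G = filterᵇ (good k K) U
      S : A → ℕ
      S x = ∑ (pairs (nbhd x K)) (joint k (nbhd x U))
      rearrange₁ : ∀ o f m e → o * f * (m * e) ≡ o * m * (f * e)
      rearrange₁ = solve-∀
      rearrange₂ : ∀ q g c → q * g * c ≡ q * (g * c)
      rearrange₂ = solve-∀
      shrink : ∀ k m → (3 + 4 * k) * m + 4 * m ≡ (3 + 4 * suc k) * m
      shrink = solve-∀

      restrict : ∀ {x} → x ∈ U → good k K x ≡ true → oddFactorial k * m ^ k ≤ Q ^ k * S x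
      restrict {x} x∈U x-good = ≤-trans
        (many-joints k (nbhd x U) Kₓ
          (λ {y} y∈ → ≤-trans (*-monoʳ-≤ Q (nonDegree-filter (a x) U y)) (deg (proj₁ (∈-filterᵇ⁻ (a x) y∈))))
          large′ |Kₓ|
          (λ y∈ → let y∈K , xy = ∈-filterᵇ⁻ (a x) (∈-take⁻ (2 + k) y∈) in ∈-filterᵇ⁺ (a x) (K⊆U y∈K) xy))
        (*-monoʳ-≤ (Q ^ k) (∑-pairs-take-≤ (2 + k) (nbhd x K) _))
        where
        -- A good vertex may see all k + 3 vertices of K; the induction hypothesis wants exactly k +
        -- 2.
        Kₓ = take (2 + k) (nbhd x K)
        |Kₓ| : length Kₓ ≡ 2 + k
        |Kₓ| = ≡.trans (length-take (2 + k) (nbhd x K)) (m≤n⇒m⊓n≡m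
          (subst (2 + k ≤_) (sym (length-filter (a x) K)) (≤ᵇ-true x-good)))
        large′ : (3 + 4 * k) * m ≤ Q * length (nbhd x U)
        large′ = +-cancelʳ-≤ (4 * m) _ _ (begin
          (3 + 4 * k) * m + 4 * m                        ≡⟨ shrink k m ⟩
          (3 + 4 * suc k) * m                            ≤⟨ large ⟩
          Q * length U                                   ≡⟨ cong (Q *_) (sym (length-nbhd x U)) ⟩
          Q * (length (nbhd x U) + nonDegree U x)        ≡⟨ *-distribˡ-+ Q _ _ ⟩
          Q * length (nbhd x U) + Q * nonDegree U x      ≤⟨ +-monoʳ-≤ (Q * length (nbhd x U)) (deg x∈U) ⟩
          Q * length (nbhd x U) + 4 * m                  ∎)

-- Extracting a blow-up

∑-cartesianProductWith : {A B C : Set} (h : A → B → C) (xs : List A) (ys : List B) (f : C → ℕ) →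
  ∑ (cartesianProductWith h xs ys) f ≡ ∑ xs (λ x → ∑ ys (λ y → f (h x y)))
∑-cartesianProductWith h []       ys f = refl
∑-cartesianProductWith h (x ∷ xs) ys f =
  ≡.trans (∑-++ (map (h x) ys) _ f) (cong₂ _+_ (∑-map (h x) ys f) (∑-cartesianProductWith h xs ys f))

∈-zipWith⁻ : {A B C : Set} (h : A → B → C) (xs : List A) (ys : List B) {z : C} → z ∈ zipWith h xs ys →
  ∃ λ x → ∃ λ y → x ∈ xs × y ∈ ys × z ≡ h x y
∈-zipWith⁻ h (x ∷ xs) (y ∷ ys) (here refl) = x , y , here refl , here refl , refl
∈-zipWith⁻ h (x ∷ xs) (y ∷ ys) (there z∈) with ∈-zipWith⁻ h xs ys z∈
... | x′ , y′ , x′∈ , y′∈ , eq = x′ , y′ , there x′∈ , there y′∈ , eq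

-- Splitting Y according to one row after the other and keeping the larger half.
homogeneous : {A B : Set} (inc : B → A → Bool) (rows : List B) (Y : List A) (q : ℕ) → Unique Y →
  q * 2 ^ length rows ≤ length Y →
  ∃ λ Y′ → q ≤ length Y′ × Unique Y′ × (∀ {y} → y ∈ Y′ → y ∈ Y) ×
    (∀ {b y z} → b ∈ rows → y ∈ Y′ → z ∈ Y′ → inc b y ≡ inc b z)
homogeneous inc [] Y q Y! large = Y , subst (_≤ length Y) (*-identityʳ q) large , Y! , (λ y∈ → y∈) , λ ()
homogeneous inc (b ∷ rows) Y q Y! large with q * 2 ^ length rows ≤? ♯ (inc b) Y
... | yes q≤ with homogeneous inc rows (filterᵇ (inc b) Y) q (AllPairs.filter⁺ (T? ∘ inc b) Y!)
                    (subst (q * 2 ^ length rows ≤_) (sym (length-filter (inc b) Y)) q≤)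
...   | Y′ , |Y′| , Y′! , Y′⊆ , const =
  Y′ , |Y′| , Y′! , (proj₁ ∘ ∈-filterᵇ⁻ (inc b) ∘ Y′⊆) ,
  λ { (here refl) y∈ z∈ → ≡.trans (proj₂ (∈-filterᵇ⁻ (inc b) {Y} (Y′⊆ y∈))) (sym (proj₂ (∈-filterᵇ⁻ (inc b) {Y} (Y′⊆ z∈))))
    ; (there b∈) y∈ z∈ → const b∈ y∈ z∈ }
homogeneous inc (b ∷ rows) Y q Y! large | no q≰
  with homogeneous inc rows (filterᵇ (not ∘ inc b) Y) q (AllPairs.filter⁺ (T? ∘ not ∘ inc b) Y!)
         (subst (q * 2 ^ length rows ≤_) (sym (length-filter (not ∘ inc b) Y)) q≤)
  where
  open ≤-Reasoning
  double : ∀ q e → q * (2 * e) ≡ q * e + q * e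
  double = solve-∀
  q≤ : q * 2 ^ length rows ≤ ♯ (not ∘ inc b) Y
  q≤ = +-cancelˡ-≤ (q * 2 ^ length rows) _ _ (begin
    q * 2 ^ length rows + q * 2 ^ length rows   ≡⟨ sym (double q (2 ^ length rows)) ⟩
    q * 2 ^ length (b ∷ rows)                   ≤⟨ large ⟩
    length Y                                    ≡⟨ sym (♯-not (inc b) Y) ⟩
    ♯ (inc b) Y + ♯ (not ∘ inc b) Y             ≤⟨ +-monoˡ-≤ _ (<⇒≤ (≰⇒> q≰)) ⟩
    q * 2 ^ length rows + ♯ (not ∘ inc b) Y     ∎)
... | Y′ , |Y′| , Y′! , Y′⊆ , const =
  Y′ , |Y′| , Y′! , (proj₁ ∘ ∈-filterᵇ⁻ (not ∘ inc b) ∘ Y′⊆) ,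
  λ { (here refl) y∈ z∈ → ≡.trans (not-true (proj₂ (∈-filterᵇ⁻ (not ∘ inc b) {Y} (Y′⊆ y∈)))) (sym (not-true (proj₂ (∈-filterᵇ⁻ (not ∘ inc b) {Y} (Y′⊆ z∈)))))
    ; (there b∈) y∈ z∈ → const b∈ y∈ z∈ }
  where
  not-true : ∀ {b} → not b ≡ true → b ≡ false
  not-true {false} _ = refl

module Extraction {A : Set} (a : A → A → Bool) (W : List A) (W! : Unique W) where
  open Counting a using (Adj)

  m : ℕ
  m = length W

  tuples : ∀ k → List (Vec A k)
  tuples zero    = [] ∷ []
  tuples (suc k) = cartesianProductWith (λ R y → y ∷ R) (tuples k) W

  ∑-tuples : ∀ k f → ∑ (tuples (suc k)) f ≡ ∑ (tuples k) (λ R → ∑ W (λ y → f (y ∷ R)))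
  ∑-tuples k f = ∑-cartesianProductWith (λ R y → y ∷ R) (tuples k) W f

  ∑-tuples-const : ∀ k c → ∑ (tuples k) (λ _ → c) ≡ m ^ k * c
  ∑-tuples-const zero c = refl
  ∑-tuples-const (suc k) c = begin
    ∑ (tuples (suc k)) (λ _ → c)           ≡⟨ ∑-tuples k _ ⟩
    ∑ (tuples k) (λ _ → ∑ W (λ _ → c))     ≡⟨ ∑-tuples-const k _ ⟩
    m ^ k * ∑ W (λ _ → c)                  ≡⟨ cong (m ^ k *_) (∑-const W c) ⟩
    m ^ k * (m * c)                        ≡⟨ rearrange (m ^ k) m c ⟩
    m * m ^ k * c                          ∎
    where
    open ≡.≡-Reasoning
    rearrange : ∀ e m c → e * (m * c) ≡ m * e * c
    rearrange = solve-∀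

  tuples-inside : ∀ k {t} → t ∈ tuples k → VecAll.All (_∈ W) t
  tuples-inside zero (here refl) = VecAll.[]
  tuples-inside (suc k) t∈ with ∈-cartesianProductWith⁻ (λ R y → y ∷ R) (tuples k) W t∈
  ... | R , y , R∈ , y∈ , refl = y∈ VecAll.∷ tuples-inside k R∈

  -- Entries in different positions are adjacent, with no condition on equal positions. Thus
  -- `CrossAdj` t t says that t spans a clique.
  CrossAdj : ∀ {k} → Vec A k → Vec A k → Set
  CrossAdj []      []      = ⊤
  CrossAdj (x ∷ R) (y ∷ S) = VecAll.All (Adj x) S × VecAll.All (Adj y) R × CrossAdj R S

  -- A blow-up stored by transversals: the i-th entries of the members form the i-th part. `cross`
  -- makes different parts completely adjacent, and `distinct` gives each part q different vertices.
  record Family {k : ℕ} (q : ℕ) (M : Vec A k → Bool) : Set where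
    constructor family
    field
      members  : List (Vec A k)
      size     : length members ≡ q
      valid    : ∀ {t} → t ∈ members → M t ≡ true
      cross    : ∀ {t t′} → t ∈ members → t′ ∈ members → CrossAdj t t′
      distinct : AllPairs (Pointwise _≢_) members

  zip-distinct : ∀ {k} (ys : List A) (Rs : List (Vec A k)) → Unique ys → AllPairs (Pointwise _≢_) Rs →
    AllPairs (Pointwise _≢_) (zipWith _∷_ ys Rs)
  zip-distinct []       _        _ _ = []
  zip-distinct (y ∷ ys) []       _ _ = []
  zip-distinct (y ∷ ys) (R ∷ Rs) (y≢ ∷ ys!) (R≢ ∷ Rs!) = head ys Rs y≢ R≢ ∷ zip-distinct ys Rs ys! Rs!
    where
    head : ∀ ys Rs → All (y ≢_) ys → All (Pointwise _≢_ R) Rs → All (Pointwise _≢_ (y ∷ R)) (zipWith _∷_ ys Rs)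
    head []       _        _ _ = []
    head (z ∷ ys) []       _ _ = []
    head (z ∷ ys) (S ∷ Rs) (y≢z ∷ y≢) (R≢S ∷ R≢) = (y≢z ∷ R≢S) ∷ head ys Rs y≢ R≢

  -- 1 / L measures the density of the tuples, and P bounds the number of rows at every level of the
  -- recursion; 2 ^ P pays for `homogeneous`.
  module _ (L P : ℕ) (L≥1 : 1 ≤ L) (P≥1 : 1 ≤ P) (m-large : 2 * L * (P * 2 ^ P) ≤ m) where

    private
      instance
        L≢0 : NonZero L
        L≢0 = >-nonZero L≥1

      m>0 : 0 < m
      m>0 = ≤-trans (*-mono-≤ (≤-trans L≥1 (m≤n*m L 2)) (*-mono-≤ P≥1 (m^n>0 2 P))) m-large

      instance
        m≢0 : NonZero m
        m≢0 = >-nonZero m>0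

      rich : ∀ {k} → (Vec A (suc k) → Bool) → Vec A k → Bool
      rich M R = m ≤ᵇ L * ♯ (λ y → M (y ∷ R)) W

      -- Tuples that are not rich have fewer than m / L extensions, together at most m^(k+1) / L,
      -- which costs one unit of the coefficient k + 2. Each rich one has at most m extensions. So L
      -- is the same at every level.
      many-rich : ∀ k (M : Vec A (suc k) → Bool) →
        (2 + k) * m ^ suc k ≤ L * ♯ M (tuples (suc k)) → suc k * m ^ k ≤ L * ♯ (rich M) (tuples k)
      many-rich k M h = *-cancelˡ-≤ m (+-cancelʳ-≤ (m * m ^ k) _ _ (begin
        m * (suc k * m ^ k) + m * m ^ k                           ≡⟨ collect k m (m ^ k) ⟩
        (2 + k) * m ^ suc k                                       ≤⟨ h ⟩
        L * ♯ M (tuples (suc k))                                  ≡⟨ cong (L *_) (∑-tuples k _) ⟩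
        L * ∑ (tuples k) deg                                      ≡⟨ sym (∑-*ˡ (tuples k) L _) ⟩
        ∑ (tuples k) (λ R → L * deg R)                            ≤⟨ ∑-mono (tuples k) (λ {R} _ → pointwise R) ⟩
        ∑ (tuples k) (λ R → L * m * ⟦ rich M R ⟧ + m)             ≡⟨ ∑-+ (tuples k) _ _ ⟩
        ∑ (tuples k) (λ R → L * m * ⟦ rich M R ⟧) + ∑ (tuples k) (λ _ → m)
                                                                  ≡⟨ cong₂ _+_ (∑-*ˡ (tuples k) (L * m) _) (∑-tuples-const k m) ⟩
        L * m * ♯ (rich M) (tuples k) + m ^ k * m                 ≡⟨ rearrange L m (♯ (rich M) (tuples k)) (m ^ k) ⟩
        m * (L * ♯ (rich M) (tuples k)) + m * m ^ k               ∎))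
        where
        open ≤-Reasoning
        deg : Vec A k → ℕ
        deg R = ♯ (λ y → M (y ∷ R)) W
        collect : ∀ k m e → m * (suc k * e) + m * e ≡ (2 + k) * (m * e)
        collect = solve-∀
        rearrange : ∀ l m c e → l * m * c + e * m ≡ m * (l * c) + m * e
        rearrange = solve-∀
        pointwise : ∀ R → L * deg R ≤ L * m * ⟦ rich M R ⟧ + m
        pointwise R with rich M R in eq
        ... | true  = ≤-trans (*-monoʳ-≤ L (♯≤length _ W)) (≤-trans (≤-reflexive (sym (*-identityʳ (L * m)))) (m≤m+n _ m))
        ... | false = ≤-trans (<⇒≤ (≤ᵇ-false eq)) (m≤n+m m _)

      -- The 2 L q rows have at least 2 q m incidences in all. Vertices y that are not heavy account
      -- for at most q m, and each heavy one for at most 2 L q.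
      many-heavy : ∀ {B : Set} (inc : B → A → Bool) (rows : List B) q → 1 ≤ q → length rows ≡ q * (2 * L) →
        (∀ {b} → b ∈ rows → m ≤ L * ♯ (inc b) W) →
        m ≤ 2 * L * ♯ (λ y → q ≤ᵇ ♯ (λ b → inc b y) rows) W
      many-heavy inc rows q q≥1 |rows| dense = *-cancelˡ-≤ (L * q) {{>-nonZero (*-mono-≤ L≥1 q≥1)}}
        (+-cancelʳ-≤ (L * (m * q)) _ _ (begin
          L * q * m + L * (m * q)                         ≡⟨ double L q m ⟩
          q * (2 * L) * m                                 ≡⟨ cong (_* m) (sym |rows|) ⟩
          length rows * m                                 ≡⟨ sym (∑-const rows m) ⟩
          ∑ rows (λ _ → m)                                ≤⟨ ∑-mono rows dense ⟩
          ∑ rows (λ b → L * ♯ (inc b) W)                  ≡⟨ ∑-*ˡ rows L _ ⟩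
          L * ∑ rows (λ b → ♯ (inc b) W)                  ≡⟨ cong (L *_) (∑-swap rows W _) ⟩
          L * ∑ W row-count                               ≤⟨ *-monoʳ-≤ L (∑-mono W (λ {y} _ → pointwise y)) ⟩
          L * ∑ W (λ y → q * (2 * L) * ⟦ heavy y ⟧ + q)   ≡⟨ cong (L *_) (≡.trans (∑-+ W _ _) (cong₂ _+_ (∑-*ˡ W (q * (2 * L)) _) (∑-const W q))) ⟩
          L * (q * (2 * L) * ♯ heavy W + m * q)           ≡⟨ rearrange L q (♯ heavy W) m ⟩
          L * q * (2 * L * ♯ heavy W) + L * (m * q)       ∎))
        where
        open ≤-Reasoning
        row-count : A → ℕ
        row-count y = ♯ (λ b → inc b y) rows
        heavy : A → Bool
        heavy y = q ≤ᵇ row-count y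
        double : ∀ l q m → l * q * m + l * (m * q) ≡ q * (2 * l) * m
        double = solve-∀
        rearrange : ∀ l q c m → l * (q * (2 * l) * c + m * q) ≡ l * q * (2 * l * c) + l * (m * q)
        rearrange = solve-∀
        pointwise : ∀ y → row-count y ≤ q * (2 * L) * ⟦ heavy y ⟧ + q
        pointwise y with heavy y in eq
        ... | true  = ≤-trans (♯≤length _ rows) (≤-trans (≤-reflexive (≡.trans |rows| (sym (*-identityʳ _)))) (m≤m+n _ q))
        ... | false = ≤-trans (<⇒≤ (≤ᵇ-false eq)) (m≤n+m q _)

    -- Each level of the recursion asks for 2 L times as many shorter tuples, hence the bound q (2
    -- L)^k ≤ P.
    extract : ∀ k q (M : Vec A k → Bool) → (∀ {t} → M t ≡ true → CrossAdj t t) →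
      1 ≤ q → q * (2 * L) ^ k ≤ P → suc k * m ^ k ≤ L * ♯ M (tuples k) → Family q M
    -- Pointwise distinctness is vacuous for empty tuples, so q copies of the empty tuple serve.
    extract zero q M clique q≥1 q-small dense = family (replicate q []) (length-replicate q)
        (λ {t} _ → M[] t) (λ {t} {t′} _ _ → cross[] t t′) (distinct[] q)
      where
      M[] : ∀ t → M t ≡ true
      M[] [] with M []
      ... | true  = refl
      ... | false = contradiction (subst (1 ≤_) (*-zeroʳ L) dense) λ ()
      cross[] : ∀ t t′ → CrossAdj t t′
      cross[] [] [] = tt
      distinct[] : ∀ q → AllPairs (Pointwise _≢_) (replicate q [])
      distinct[] zero    = []
      distinct[] (suc q) = All.replicate⁺ q [] ∷ distinct[] q
    extract (suc k) q M clique q≥1 q-small dense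
      with extract k (q * (2 * L)) (rich M) rich-clique (*-mono-≤ q≥1 (≤-trans L≥1 (m≤n*m L 2)))
             (subst (_≤ P) (sym (*-assoc q (2 * L) ((2 * L) ^ k))) q-small) (many-rich k M dense)
      where
      -- As m > 0, a rich R has some extension, and the clique it spans contains R.
      rich-clique : ∀ {R} → rich M R ≡ true → CrossAdj R R
      rich-clique {R} e with ♯-positive (λ y → M (y ∷ R)) W
        (n≢0⇒n>0 λ zero♯ → <⇒≱ m>0 (subst (m ≤_) (≡.trans (cong (L *_) zero♯) (*-zeroʳ L)) (≤ᵇ-true e)))
      ... | y , _ , My = proj₂ (proj₂ (clique {y ∷ R} My))
    ... | family Rs |Rs| rich-Rs cross-Rs Rs! with homogeneous (λ R y → M (y ∷ R)) Rs Y q (AllPairs.filter⁺ (T? ∘ heavy) W!) Y-large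
      where
      heavy : A → Bool
      heavy y = q ≤ᵇ ♯ (λ R → M (y ∷ R)) Rs
      Y = filterᵇ heavy W
      open ≤-Reasoning
      p≤P : length Rs ≤ P
      p≤P = begin
        length Rs                     ≡⟨ |Rs| ⟩
        q * (2 * L)                   ≤⟨ m≤m*n (q * (2 * L)) ((2 * L) ^ k) {{m^n≢0 (2 * L) k {{m*n≢0 2 L}}}} ⟩
        q * (2 * L) * (2 * L) ^ k     ≡⟨ *-assoc q (2 * L) _ ⟩
        q * (2 * L) ^ suc k           ≤⟨ q-small ⟩
        P                             ∎
      q≤P : q ≤ P
      q≤P = ≤-trans (m≤m*n q ((2 * L) ^ suc k) {{m^n≢0 (2 * L) (suc k) {{m*n≢0 2 L}}}}) q-small
      Y-large : q * 2 ^ length Rs ≤ length Y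
      Y-large = *-cancelˡ-≤ (2 * L) {{m*n≢0 2 L}} (begin
        2 * L * (q * 2 ^ length Rs)   ≤⟨ *-monoʳ-≤ (2 * L) (*-mono-≤ q≤P (^-monoʳ-≤ 2 p≤P)) ⟩
        2 * L * (P * 2 ^ P)           ≤⟨ m-large ⟩
        m                             ≤⟨ many-heavy (λ R y → M (y ∷ R)) Rs q q≥1 |Rs| (≤ᵇ-true ∘ rich-Rs) ⟩
        2 * L * ♯ heavy W             ≡⟨ cong (2 * L *_) (sym (length-filter heavy W)) ⟩
        2 * L * length Y              ∎)
    ... | [] , q≤0 , _ = contradiction (≤-trans q≥1 q≤0) λ ()
    ... | Y′@(y₀ ∷ _) , |Y′| , Y′! , Y′⊆Y , const = family T |T| valid cross distinct
      where
      -- All y in Y′ extend the same rows, so those of y₀ serve for all; since y₀ is heavy there are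
      -- at least q.
      Rs′ = filterᵇ (λ R → M (y₀ ∷ R)) Rs
      ys = take q Y′
      Ss = take q Rs′
      T = zipWith _∷_ ys Ss

      q≤|Rs′| : q ≤ length Rs′
      q≤|Rs′| = subst (q ≤_) (sym (length-filter _ Rs))
        (≤ᵇ-true (proj₂ (∈-filterᵇ⁻ (λ y → q ≤ᵇ ♯ (λ R → M (y ∷ R)) Rs) {W} (Y′⊆Y (here refl)))))

      |T| : length T ≡ q
      |T| = ≡.trans (length-zipWith _∷_ ys Ss) (≡.trans
        (cong₂ _⊓_ (≡.trans (length-take q Y′) (m≤n⇒m⊓n≡m |Y′|)) (≡.trans (length-take q Rs′) (m≤n⇒m⊓n≡m q≤|Rs′|)))
        (⊓-idem q))

      valid-mixed : ∀ {y S} → y ∈ ys → S ∈ Ss → M (y ∷ S) ≡ true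
      valid-mixed y∈ S∈ with ∈-filterᵇ⁻ (λ R → M (y₀ ∷ R)) {Rs} (∈-take⁻ q S∈)
      ... | S∈Rs , MS = ≡.trans (const S∈Rs (∈-take⁻ q y∈) (here refl)) MS

      valid : ∀ {t} → t ∈ T → M t ≡ true
      valid t∈ with ∈-zipWith⁻ _∷_ ys Ss t∈
      ... | y , S , y∈ , S∈ , refl = valid-mixed y∈ S∈

      cross : ∀ {t t′} → t ∈ T → t′ ∈ T → CrossAdj t t′
      cross t∈ t′∈ with ∈-zipWith⁻ _∷_ ys Ss t∈ | ∈-zipWith⁻ _∷_ ys Ss t′∈
      ... | y , S , y∈ , S∈ , refl | y′ , S′ , y′∈ , S′∈ , refl =
        proj₁ (clique (valid-mixed y∈ S′∈)) , proj₁ (clique (valid-mixed y′∈ S∈)) ,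
        cross-Rs (inRs S∈) (inRs S′∈)
        where
        inRs : ∀ {S} → S ∈ Ss → S ∈ Rs
        inRs S∈ = proj₁ (∈-filterᵇ⁻ (λ R → M (y₀ ∷ R)) (∈-take⁻ q S∈))

      distinct : AllPairs (Pointwise _≢_) T
      distinct = zip-distinct ys Ss (AllPairs.take⁺ q Y′!) (AllPairs.take⁺ q (AllPairs.filter⁺ (T? ∘ λ R → M (y₀ ∷ R)) Rs!))

-- Edge counts and Turán numbers

sumBelow : ℕ → (ℕ → ℕ) → ℕ
sumBelow zero    f = 0
sumBelow (suc n) f = sumBelow n f + f n

sumBelow-cong : ∀ n {f g : ℕ → ℕ} → (∀ i → f i ≡ g i) → sumBelow n f ≡ sumBelow n g
sumBelow-cong zero    h = refl
sumBelow-cong (suc n) h = cong₂ _+_ (sumBelow-cong n h) (h n)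

sumBelow-+ : ∀ n (f g : ℕ → ℕ) → sumBelow n (λ i → f i + g i) ≡ sumBelow n f + sumBelow n g
sumBelow-+ zero    f g = refl
sumBelow-+ (suc n) f g = ≡.trans (cong (_+ (f n + g n)) (sumBelow-+ n f g)) (interchange (sumBelow n f) _ (f n) (g n))

sumBelow-suc : ∀ n f → sumBelow (suc n) f ≡ f 0 + sumBelow n (f ∘ suc)
sumBelow-suc zero    f = sym (+-identityʳ (f 0))
sumBelow-suc (suc n) f = ≡.trans (cong (_+ f (suc n)) (sumBelow-suc n f)) (+-assoc (f 0) _ _)

∑-tabulate : {B : Set} (n : ℕ) (h : Fin n → B) (F : B → ℕ) (f : ℕ → ℕ) →
  (∀ i → F (h i) ≡ f (toℕ i)) → ∑ (tabulate h) F ≡ sumBelow n f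
∑-tabulate zero    h F f e = refl
∑-tabulate (suc n) h F f e =
  ≡.trans (cong₂ _+_ (e zero) (∑-tabulate n (h ∘ suc) F (f ∘ suc) (e ∘ suc))) (sym (sumBelow-suc n f))

sum-map : {A : Set} (f : A → ℕ) (xs : List A) → sum (map f xs) ≡ ∑ xs f
sum-map f []       = refl
sum-map f (x ∷ xs) = cong (f x +_) (sum-map f xs)

<ᵇ-true : ∀ {m n} → m < n → (m <ᵇ n) ≡ true
<ᵇ-true m<n = Equivalence.to T-≡ (<⇒<ᵇ m<n)

<ᵇ-false : ∀ {m n} → ¬ (m < n) → (m <ᵇ n) ≡ false
<ᵇ-false {m} {n} m≮n with m <ᵇ n in e
... | false = refl
... | true  = contradiction (<ᵇ⇒< m n (Equivalence.from T-≡ e)) m≮n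

≡ᵇ-refl : ∀ m → (m ≡ᵇ m) ≡ true
≡ᵇ-refl m = Equivalence.to T-≡ (≡⇒≡ᵇ m m refl)

≡ᵇ-true : ∀ {m n} → (m ≡ᵇ n) ≡ true → m ≡ n
≡ᵇ-true {m} {n} e = ≡ᵇ⇒≡ m n (Equivalence.from T-≡ e)

≡ᵇ-sym : ∀ m n → (m ≡ᵇ n) ≡ (n ≡ᵇ m)
≡ᵇ-sym zero    zero    = refl
≡ᵇ-sym zero    (suc n) = refl
≡ᵇ-sym (suc m) zero    = refl
≡ᵇ-sym (suc m) (suc n) = ≡ᵇ-sym m n

if-⟦⟧ : ∀ b → (if b then 1 else 0) ≡ ⟦ b ⟧
if-⟦⟧ true  = refl
if-⟦⟧ false = refl

doubleSum : ∀ n → (Fin n → Fin n → Bool) → ℕ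
doubleSum n b = ∑ (allFin n) (λ i → ♯ (b i) (allFin n))

module _ (n : ℕ) (b : Fin n → Fin n → Bool) where

  countPairs-∑ : countPairs n b ≡ doubleSum n (λ i j → (toℕ i <ᵇ toℕ j) ∧ b i j)
  countPairs-∑ = ≡.trans (sum-map _ (cartesianProductWith _,_ (allFin n) (allFin n)))
    (≡.trans (∑-cartesianProductWith _,_ (allFin n) (allFin n) _)
      (∑-cong (allFin n) (λ i → ∑-cong (allFin n) (λ j → if-⟦⟧ ((toℕ i <ᵇ toℕ j) ∧ b i j)))))

  doubleSum-complement : doubleSum n b + doubleSum n (λ i j → not (b i j)) ≡ n * n
  doubleSum-complement = begin
    doubleSum n b + doubleSum n (λ i j → not (b i j))
      ≡⟨ sym (∑-+ (allFin n) _ _) ⟩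
    ∑ (allFin n) (λ i → ♯ (b i) (allFin n) + ♯ (not ∘ b i) (allFin n))
      ≡⟨ ∑-cong (allFin n) (λ i → ♯-not (b i) (allFin n)) ⟩
    ∑ (allFin n) (λ _ → length (allFin n))
      ≡⟨ ∑-const (allFin n) _ ⟩
    length (allFin n) * length (allFin n)
      ≡⟨ cong₂ _*_ |allFin| |allFin| ⟩
    n * n ∎
    where
    open ≡.≡-Reasoning
    |allFin| = length-tabulate {n = n} (λ i → i)

  2*countPairs : (∀ i j → b i j ≡ b j i) → (∀ i → b i i ≡ false) → 2 * countPairs n b ≡ doubleSum n b
  2*countPairs b-sym b-irrefl = begin
    2 * countPairs n b                            ≡⟨ cong (2 *_) countPairs-∑ ⟩
    2 * D                                         ≡⟨ cong (D +_) (+-identityʳ D) ⟩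
    D + D                                         ≡⟨ cong (D +_) (∑-swap (allFin n) (allFin n) _) ⟩
    D + doubleSum n (λ i j → (toℕ j <ᵇ toℕ i) ∧ b j i)
      ≡⟨ sym (∑-+ (allFin n) _ _) ⟩
    ∑ (allFin n) (λ i → ♯ (λ j → (toℕ i <ᵇ toℕ j) ∧ b i j) (allFin n) + ♯ (λ j → (toℕ j <ᵇ toℕ i) ∧ b j i) (allFin n))
      ≡⟨ ∑-cong (allFin n) (λ i → sym (∑-+ (allFin n) _ _)) ⟩
    ∑ (allFin n) (λ i → ∑ (allFin n) (λ j → ⟦ (toℕ i <ᵇ toℕ j) ∧ b i j ⟧ + ⟦ (toℕ j <ᵇ toℕ i) ∧ b j i ⟧))
      ≡⟨ ∑-cong (allFin n) (λ i → ∑-cong (allFin n) (pointwise i)) ⟩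
    doubleSum n b ∎
    where
    open ≡.≡-Reasoning
    D = doubleSum n (λ i j → (toℕ i <ᵇ toℕ j) ∧ b i j)
    pointwise : ∀ i j → ⟦ (toℕ i <ᵇ toℕ j) ∧ b i j ⟧ + ⟦ (toℕ j <ᵇ toℕ i) ∧ b j i ⟧ ≡ ⟦ b i j ⟧
    pointwise i j with <-cmp (toℕ i) (toℕ j)
    ... | tri< i<j _ j≮i rewrite <ᵇ-true i<j | <ᵇ-false j≮i = +-identityʳ _
    ... | tri> i≮j _ j<i rewrite <ᵇ-true j<i | <ᵇ-false i≮j = cong ⟦_⟧ (b-sym j i)
    ... | tri≈ i≮j i≡j j≮i rewrite Fin.toℕ-injective i≡j | <ᵇ-false (<-irrefl {toℕ j} refl) | b-irrefl j = refl

-- Residue classes as the parts of the Turán graph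

module _ (k : ℕ) where

  -- `remainder` repeats the recursion behind `turanAdj`, so that the two agree by induction.
  remainder quotient : ℕ → ℕ
  remainder zero    = 0
  remainder (suc i) = if remainder i ≡ᵇ k then 0 else suc (remainder i)
  quotient zero    = 0
  quotient (suc i) = if remainder i ≡ᵇ k then suc (quotient i) else quotient i

  remainder≤k : ∀ i → remainder i ≤ k
  remainder≤k zero = z≤n
  remainder≤k (suc i) with remainder i ≡ᵇ k in e
  ... | true  = z≤n
  ... | false = ≤∧≢⇒< (remainder≤k i) λ eq → contradiction (≡.trans (sym e) (≡.trans (cong (_≡ᵇ k) eq) (≡ᵇ-refl k))) λ ()

  quotient-remainder : ∀ i → quotient i * suc k + remainder i ≡ i
  quotient-remainder zero = refl
  quotient-remainder (suc i) with remainder i ≡ᵇ k in e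
  ... | true  = ≡.trans (step k (quotient i)) (cong suc (≡.trans (cong (quotient i * suc k +_) (sym (≡ᵇ-true e))) (quotient-remainder i)))
    where
    step : ∀ k q → suc q * suc k + 0 ≡ suc (q * suc k + k)
    step = solve-∀
  ... | false = ≡.trans (+-suc _ _) (cong suc (quotient-remainder i))

  quotient≤ : ∀ i → quotient i ≤ i / suc k
  quotient≤ i = subst (_≤ i / suc k) (m*n/n≡m (quotient i) (suc k))
    (/-monoˡ-≤ (suc k) (subst (quotient i * suc k ≤_) (quotient-remainder i) (m≤m+n _ _)))

  private
    ⟦<suc⟧ : ∀ x y → ⟦ x <ᵇ suc y ⟧ ≡ ⟦ x <ᵇ y ⟧ + ⟦ y ≡ᵇ x ⟧
    ⟦<suc⟧ zero    zero    = refl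
    ⟦<suc⟧ zero    (suc y) = refl
    ⟦<suc⟧ (suc x) zero    = refl
    ⟦<suc⟧ (suc x) (suc y) = ⟦<suc⟧ x y

  -- Each completed cycle contains every residue once, and the unfinished one contains those below
  -- `remainder` i. When a cycle closes, the 1 in the bracket moves into the quotient.
  residue-count : ∀ i x → x ≤ k →
    sumBelow i (λ j → ⟦ remainder j ≡ᵇ x ⟧) ≡ quotient i + ⟦ x <ᵇ remainder i ⟧
  residue-count zero x x≤k = refl
  residue-count (suc i) x x≤k rewrite residue-count i x x≤k with remainder i ≡ᵇ k in e
  ... | false = ≡.trans (+-assoc (quotient i) _ _) (cong (quotient i +_) (sym (⟦<suc⟧ x (remainder i))))
  ... | true  = begin
    quotient i + ⟦ x <ᵇ remainder i ⟧ + ⟦ remainder i ≡ᵇ x ⟧    ≡⟨ +-assoc (quotient i) _ _ ⟩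
    quotient i + (⟦ x <ᵇ remainder i ⟧ + ⟦ remainder i ≡ᵇ x ⟧)  ≡⟨ cong (quotient i +_) (sym (⟦<suc⟧ x (remainder i))) ⟩
    quotient i + ⟦ x <ᵇ suc (remainder i) ⟧                     ≡⟨ cong (λ z → quotient i + ⟦ x <ᵇ suc z ⟧) (≡ᵇ-true e) ⟩
    quotient i + ⟦ x <ᵇ suc k ⟧                                 ≡⟨ cong (λ z → quotient i + ⟦ z ⟧) (<ᵇ-true (s≤s x≤k)) ⟩
    quotient i + 1                                              ≡⟨ +-suc (quotient i) 0 ⟩
    suc (quotient i) + 0                                        ∎
    where open ≡.≡-Reasoning

  -- A new vertex n forms two ordered pairs with each of the `quotient` n earlier vertices of its
  -- class, and one with itself.
  samePart-residues : ∀ n → sumBelow n (λ i → sumBelow n (λ j → ⟦ remainder i ≡ᵇ remainder j ⟧)) ≤ samePart k n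
  samePart-residues zero = z≤n
  samePart-residues (suc n) = begin
    sumBelow n (λ i → sumBelow n (E i) + E i n) + (sumBelow n (E n) + E n n)
      ≡⟨ cong₂ _+_ (sumBelow-+ n _ _) (cong₂ _+_ (sumBelow-cong n (λ j → cong ⟦_⟧ (≡ᵇ-sym (remainder n) (remainder j)))) (cong ⟦_⟧ (≡ᵇ-refl (remainder n)))) ⟩
    sumBelow n (λ i → sumBelow n (E i)) + sumBelow n (λ i → E i n) + (sumBelow n (λ i → E i n) + 1)
      ≡⟨ cong (λ z → sumBelow n (λ i → sumBelow n (E i)) + z + (z + 1)) own-class ⟩
    sumBelow n (λ i → sumBelow n (E i)) + quotient n + (quotient n + 1)
      ≡⟨ collect _ (quotient n) ⟩
    sumBelow n (λ i → sumBelow n (E i)) + suc (2 * quotient n)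
      ≤⟨ +-mono-≤ (samePart-residues n) (s≤s (*-monoʳ-≤ 2 (quotient≤ n))) ⟩
    samePart k n + suc (2 * (n / suc k)) ∎
    where
    open ≤-Reasoning
    E : ℕ → ℕ → ℕ
    E i j = ⟦ remainder i ≡ᵇ remainder j ⟧
    own-class : sumBelow n (λ i → E i n) ≡ quotient n
    own-class = ≡.trans (residue-count n (remainder n) (remainder≤k n))
      (≡.trans (cong (λ z → quotient n + ⟦ z ⟧) (<ᵇ-false (<-irrefl {remainder n} refl))) (+-identityʳ _))
    collect : ∀ s q → s + q + (q + 1) ≡ s + suc (2 * q)
    collect = solve-∀

-- The residue function used by turanAdj is not exported by Defs. Against the fixed vertex 1, whose
-- residue unfolds to a term stuck on k, it can be recovered by unification.
private
  turanAdj-residue : Σ (∀ k n → Fin (2 + n) → ℕ) λ ρ → ∀ k n j →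
    turanAdj k (2 + n) (suc zero) j ≡ not ((if 0 ≡ᵇ k then 0 else 1) ≡ᵇ ρ k n j)
  turanAdj-residue = _ , λ k n j → refl

  ρ : ∀ k n → Fin (2 + n) → ℕ
  ρ = proj₁ turanAdj-residue

  ρ-remainder : ∀ k n i → ρ k n i ≡ remainder k (toℕ i)
  ρ-remainder k n       zero       = refl
  ρ-remainder k zero    (suc zero) = refl
  ρ-remainder k (suc n) (suc i)    = cong (λ m → if m ≡ᵇ k then 0 else suc m) (ρ-remainder k n i)

turanAdj-remainder : ∀ k n (i j : Fin (2 + n)) →
  turanAdj k (2 + n) i j ≡ not (remainder k (toℕ i) ≡ᵇ remainder k (toℕ j))
turanAdj-remainder k n i j = cong₂ (λ u v → not (u ≡ᵇ v)) (ρ-remainder k n i) (ρ-remainder k n j)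

-- Of the N² ordered pairs, the adjacent ones are twice the edges, and the rest lie inside residue
-- classes.
2*turanNumber : ∀ k n → 2 * turanNumber (suc k) (2 + n) + samePart k (2 + n) ≥ (2 + n) * (2 + n)
2*turanNumber k n = begin
  N * N                                                                       ≡⟨ sym (doubleSum-complement N t) ⟩
  doubleSum N t + doubleSum N (λ i j → not (t i j))                           ≡⟨ cong₂ _+_ (sym (2*countPairs N t t-sym t-irrefl)) complement ⟩
  2 * turanNumber (suc k) N + sumBelow N (λ i → sumBelow N (λ j → ⟦ remainder k i ≡ᵇ remainder k j ⟧))
                                                                              ≤⟨ +-monoʳ-≤ (2 * turanNumber (suc k) N) (samePart-residues k N) ⟩
  2 * turanNumber (suc k) N + samePart k N                                    ∎
  where
  open ≤-Reasoning
  N = 2 + n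
  t = turanAdj k N
  t-sym : ∀ i j → t i j ≡ t j i
  t-sym i j = cong not (≡ᵇ-sym (ρ k n i) (ρ k n j))
  t-irrefl : ∀ i → t i i ≡ false
  t-irrefl i = cong not (≡ᵇ-refl (ρ k n i))
  complement : doubleSum N (λ i j → not (t i j)) ≡
    sumBelow N (λ i → sumBelow N (λ j → ⟦ remainder k i ≡ᵇ remainder k j ⟧))
  complement = ∑-tabulate N (λ i → i) _ _ λ i → ∑-tabulate N (λ j → j) _ _ λ j →
    cong ⟦_⟧ (≡.trans (cong not (turanAdj-remainder k n i j)) (not-involutive _))

turán-excess : ∀ k n (G : Graph (2 + n)) → edgeCount G ≡ turanNumber (suc k) (2 + n) + 1 →
  Counting.nonEdges (adj G) (allFin (2 + n)) < samePart k (2 + n)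
turán-excess k n G edges = +-cancelˡ-< (2 * turanNumber (suc k) N) _ _ (begin-strict
  2 * turanNumber (suc k) N + E             <⟨ +-monoˡ-< E (*-monoʳ-< 2 (m<m+n (turanNumber (suc k) N) z<s)) ⟩
  2 * (turanNumber (suc k) N + 1) + E       ≡⟨ cong (λ e → 2 * e + E) (sym edges) ⟩
  2 * edgeCount G + E                       ≡⟨ cong (_+ E) (2*countPairs N (adj G) (Graph.sym G) (irrefl G)) ⟩
  doubleSum N (adj G) + E                   ≡⟨ doubleSum-complement N (adj G) ⟩
  N * N                                     ≤⟨ 2*turanNumber k n ⟩
  2 * turanNumber (suc k) N + samePart k N  ∎)
  where
  open ≤-Reasoning
  N = 2 + n
  E = Counting.nonEdges (adj G) (allFin N)

-- Tuples spanning a joint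

∧-true : ∀ {b c} → (b ∧ c) ≡ true → b ≡ true × c ≡ true
∧-true {true} {true} _ = refl , refl

⟦∧⟧ : ∀ b c → ⟦ b ∧ c ⟧ ≡ ⟦ b ⟧ * ⟦ c ⟧
⟦∧⟧ true  c = sym (+-identityʳ ⟦ c ⟧)
⟦∧⟧ false c = refl

filter-∧ : {A : Set} (p q : A → Bool) (xs : List A) → filterᵇ q (filterᵇ p xs) ≡ filterᵇ (λ x → p x ∧ q x) xs
filter-∧ p q [] = refl
filter-∧ p q (x ∷ xs) with p x
... | false = filter-∧ p q xs
... | true with q x
...   | true  = cong (x ∷_) (filter-∧ p q xs)
...   | false = filter-∧ p q xs

module Density {A : Set} (a : A → A → Bool) (a-sym : ∀ x y → a x y ≡ a y x)
  (W : List A) (W! : Unique W) where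
  open Counting a
  open Joints a a-sym
  open Extraction a W W!

  -- Adjacency to earlier entries is absorbed into P, just as `cliques` shrinks its vertex set.
  cliqueIn : ∀ {k} → (A → Bool) → Vec A k → Bool
  cliqueIn P []      = true
  cliqueIn P (x ∷ R) = P x ∧ cliqueIn (λ z → P z ∧ a x z) R

  cliqueIn-all : ∀ {k} P (R : Vec A k) → cliqueIn P R ≡ true → VecAll.All (λ x → P x ≡ true) R
  cliqueIn-all P []      _ = VecAll.[]
  cliqueIn-all P (x ∷ R) h with ∧-true {P x} h
  ... | Px , h′ = Px VecAll.∷ VecAll.map (proj₁ ∘ ∧-true) (cliqueIn-all _ R h′)

  cliqueIn-cross : ∀ {k} P (R : Vec A k) → cliqueIn P R ≡ true → CrossAdj R R
  cliqueIn-cross P []      _ = tt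
  cliqueIn-cross P (x ∷ R) h with ∧-true {P x} h
  ... | _ , h′ = adj-x , adj-x , cliqueIn-cross _ R h′
    where adj-x = VecAll.map (λ {z} → proj₂ ∘ ∧-true {P z}) (cliqueIn-all _ R h′)

  -- `cliques` chooses the head first, `tuples` chooses it last; hence the exchange of sums.
  cliques-tuples : ∀ k P → cliques k (filterᵇ P W) ≡ ♯ (cliqueIn P) (tuples k)
  cliques-tuples zero    P = refl
  cliques-tuples (suc k) P = begin
    ∑ (filterᵇ P W) (λ x → cliques k (nbhd x (filterᵇ P W)))
      ≡⟨ ∑-filter P W _ ⟩
    ∑ W (λ x → ⟦ P x ⟧ * cliques k (nbhd x (filterᵇ P W)))
      ≡⟨ ∑-cong W (λ x → cong (⟦ P x ⟧ *_) (≡.trans (cong (cliques k) (filter-∧ P (a x) W)) (cliques-tuples k (Pₓ x)))) ⟩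
    ∑ W (λ x → ⟦ P x ⟧ * ♯ (cliqueIn (Pₓ x)) (tuples k))
      ≡⟨ ∑-cong W (λ x → sym (∑-*ˡ (tuples k) ⟦ P x ⟧ _)) ⟩
    ∑ W (λ x → ∑ (tuples k) (λ R → ⟦ P x ⟧ * ⟦ cliqueIn (Pₓ x) R ⟧))
      ≡⟨ ∑-cong W (λ x → ∑-cong (tuples k) (λ R → sym (⟦∧⟧ (P x) (cliqueIn (Pₓ x) R)))) ⟩
    ∑ W (λ x → ∑ (tuples k) (λ R → ⟦ cliqueIn P (x ∷ R) ⟧))
      ≡⟨ ∑-swap W (tuples k) _ ⟩
    ∑ (tuples k) (λ R → ∑ W (λ x → ⟦ cliqueIn P (x ∷ R) ⟧))
      ≡⟨ sym (∑-tuples k _) ⟩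
    ♯ (cliqueIn P) (tuples (suc k)) ∎
    where
    open ≡.≡-Reasoning
    Pₓ : A → A → Bool
    Pₓ x z = P z ∧ a x z

  adjAll : ∀ {k} → A → Vec A k → Bool
  adjAll y []      = true
  adjAll y (x ∷ R) = a y x ∧ adjAll y R

  adjAll-all : ∀ {k} y (R : Vec A k) → adjAll y R ≡ true → VecAll.All (Adj y) R
  adjAll-all y []      _ = VecAll.[]
  adjAll-all y (x ∷ R) h with ∧-true {a y x} h
  ... | yx , h′ = yx VecAll.∷ adjAll-all y R h′

  -- A union bound: each entry of R excludes at most 4 m / Q vertices.
  common-nbrs : ∀ {k} Q (R : Vec A k) → VecAll.All (λ x → Q * nonDegree W x ≤ 4 * m) R →
    Q * m ≤ Q * ♯ (λ y → adjAll y R) W + k * (4 * m)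
  common-nbrs Q [] _ = ≤-reflexive (≡.trans (cong (Q *_) (sym (≡.trans (∑-const W 1) (*-identityʳ m)))) (sym (+-identityʳ _)))
  common-nbrs {suc k} Q (x ∷ R) (dx VecAll.∷ dR) = begin
    Q * m                                                    ≤⟨ common-nbrs Q R dR ⟩
    Q * ♯ (λ y → adjAll y R) W + k * (4 * m)                 ≤⟨ +-monoˡ-≤ (k * (4 * m)) (*-monoʳ-≤ Q (∑-mono W (λ {y} _ → drop (a y x) (a x y) (a-sym y x) (adjAll y R)))) ⟩
    Q * ∑ W (λ y → ⟦ adjAll y (x ∷ R) ⟧ + ⟦ not (a x y) ⟧) + k * (4 * m)
                                                             ≡⟨ cong (λ z → Q * z + k * (4 * m)) (∑-+ W _ _) ⟩
    Q * (♯ (λ y → adjAll y (x ∷ R)) W + nonDegree W x) + k * (4 * m)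
                                                             ≡⟨ rearrange Q _ (nonDegree W x) (k * (4 * m)) ⟩
    Q * ♯ (λ y → adjAll y (x ∷ R)) W + (Q * nonDegree W x + k * (4 * m))
                                                             ≤⟨ +-monoʳ-≤ (Q * ♯ (λ y → adjAll y (x ∷ R)) W) (+-monoˡ-≤ (k * (4 * m)) dx) ⟩
    Q * ♯ (λ y → adjAll y (x ∷ R)) W + (4 * m + k * (4 * m)) ∎
    where
    open ≤-Reasoning
    drop : ∀ b b′ → b ≡ b′ → ∀ c → ⟦ c ⟧ ≤ ⟦ b ∧ c ⟧ + ⟦ not b′ ⟧
    drop true  _ refl c     = m≤m+n _ 0
    drop false _ refl true  = ≤-refl
    drop false _ refl false = z≤n
    rearrange : ∀ q u v w → q * (u + v) + w ≡ q * u + (q * v + w)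
    rearrange = solve-∀

  -- R completes uv to a clique, while y only has to see R. So y plays the same role as u and v, and
  -- all three kinds of vertex can share a part.
  jointTuple : ∀ {k} → A × A → Vec A (suc k) → Bool
  jointTuple (u , v) (y ∷ R) = cliqueIn (λ z → a u z ∧ a v z) R ∧ adjAll y R

  jointTuple-cross : ∀ {k} e (t : Vec A (suc k)) → jointTuple e t ≡ true → CrossAdj t t
  jointTuple-cross (u , v) (y ∷ R) h with ∧-true {cliqueIn (λ z → a u z ∧ a v z) R} h
  ... | hR , hy = adjAll-all y R hy , adjAll-all y R hy , cliqueIn-cross _ R hR

  jointTuple-adj : ∀ {k} u v y (R : Vec A k) → jointTuple (u , v) (y ∷ R) ≡ true →
    VecAll.All (λ z → Adj u z × Adj v z) R
  jointTuple-adj u v y R h with ∧-true {cliqueIn (λ z → a u z ∧ a v z) R} h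
  ... | hR , _ = VecAll.map ∧-true (cliqueIn-all _ R hR)

  module _ (k : ℕ) (deg : ∀ {x} → x ∈ W → (3 + 4 * k) * nonDegree W x ≤ 4 * m) where

    private
      Q = 3 + 4 * k

    -- The k entries of R exclude at most 4 k m of Q m = (4 k + 3) m in `common-nbrs`, which leaves
    -- 3 m.
    many-jointTuples : ∀ e → 3 * m * joint k W e ≤ Q * ♯ (jointTuple e) (tuples (suc k))
    many-jointTuples e@(u , v) = begin
      3 * m * joint k W e                                            ≡⟨ cong (λ z → 3 * m * cliques k z) (filter-∧ (a u) (a v) W) ⟩
      3 * m * cliques k (filterᵇ P W)                                ≡⟨ cong (3 * m *_) (cliques-tuples k P) ⟩
      3 * m * ♯ (cliqueIn P) (tuples k)                              ≡⟨ sym (∑-*ˡ (tuples k) (3 * m) _) ⟩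
      ∑ (tuples k) (λ R → 3 * m * ⟦ cliqueIn P R ⟧)                  ≤⟨ ∑-mono (tuples k) (λ {R} R∈ → *-monoˡ-≤ ⟦ cliqueIn P R ⟧ (extensions R R∈)) ⟩
      ∑ (tuples k) (λ R → Q * ♯ (λ y → adjAll y R) W * ⟦ cliqueIn P R ⟧)
                                                                     ≡⟨ ∑-cong (tuples k) expand ⟩
      ∑ (tuples k) (λ R → Q * ♯ (λ y → jointTuple e (y ∷ R)) W)      ≡⟨ ∑-*ˡ (tuples k) Q _ ⟩
      Q * ∑ (tuples k) (λ R → ♯ (λ y → jointTuple e (y ∷ R)) W)      ≡⟨ cong (Q *_) (sym (∑-tuples k _)) ⟩
      Q * ♯ (jointTuple e) (tuples (suc k))                          ∎
      where
      open ≤-Reasoning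
      P : A → Bool
      P z = a u z ∧ a v z
      split : ∀ k m → 3 * m + k * (4 * m) ≡ (3 + 4 * k) * m
      split = solve-∀
      rearrange : ∀ q s c → q * s * c ≡ q * (c * s)
      rearrange = solve-∀
      extensions : ∀ R → R ∈ tuples k → 3 * m ≤ Q * ♯ (λ y → adjAll y R) W
      extensions R R∈ = +-cancelʳ-≤ (k * (4 * m)) _ _ (≤-trans (≤-reflexive (split k m))
        (common-nbrs Q R (VecAll.map deg (tuples-inside k R∈))))
      expand : ∀ R → Q * ♯ (λ y → adjAll y R) W * ⟦ cliqueIn P R ⟧ ≡ Q * ♯ (λ y → jointTuple e (y ∷ R)) W
      expand R = ≡.trans (rearrange Q (♯ (λ y → adjAll y R) W) ⟦ cliqueIn P R ⟧) (cong (Q *_)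
        (≡.trans (sym (∑-*ˡ W ⟦ cliqueIn P R ⟧ _)) (∑-cong W (λ y → sym (⟦∧⟧ (cliqueIn P R) (adjAll y R))))))

    -- Averaging `many-joints` over the (k + 2)(k + 1) / 2 pairs of a clique from `turán`. The 6 is
    -- this 2 times the 3 of `many-jointTuples`.
    dense-joint : nonEdges W < samePart k m → ∃ λ e → Adj (proj₁ e) (proj₂ e) ×
      6 * oddFactorial k * m ^ suc k ≤ (2 + k) * suc k * Q ^ suc k * ♯ (jointTuple e) (tuples (suc k))
    dense-joint dense with turán k W dense
    ... | clique K@(x ∷ y ∷ K′) |K| K-adj K⊆W with average (x , y) _ (joint k W)
    ... | e , e∈ , avg = e , ∈-pairs K-adj e∈ , (begin
      6 * oddFactorial k * (m * m ^ k)                           ≡⟨ rearrange₁ (oddFactorial k) m (m ^ k) ⟩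
      6 * m * (oddFactorial k * m ^ k)                           ≤⟨ *-monoʳ-≤ (6 * m) (many-joints Q m k W K deg ≤-refl |K| K⊆W) ⟩
      6 * m * (Q ^ k * ∑ (pairs K) (joint k W))                  ≤⟨ *-monoʳ-≤ (6 * m) (*-monoʳ-≤ (Q ^ k) avg) ⟩
      6 * m * (Q ^ k * (length (pairs K) * joint k W e))         ≡⟨ rearrange₂ m (Q ^ k) (length (pairs K)) (joint k W e) ⟩
      2 * length (pairs K) * Q ^ k * (3 * m * joint k W e)       ≡⟨ cong (λ z → z * Q ^ k * (3 * m * joint k W e)) |pairs| ⟩
      (2 + k) * suc k * Q ^ k * (3 * m * joint k W e)            ≤⟨ *-monoʳ-≤ ((2 + k) * suc k * Q ^ k) (many-jointTuples e) ⟩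
      (2 + k) * suc k * Q ^ k * (Q * ♯ (jointTuple e) (tuples (suc k)))
                                                                 ≡⟨ rearrange₃ ((2 + k) * suc k) (Q ^ k) Q (♯ (jointTuple e) (tuples (suc k))) ⟩
      (2 + k) * suc k * Q ^ suc k * ♯ (jointTuple e) (tuples (suc k)) ∎)
      where
      open ≤-Reasoning
      rearrange₁ : ∀ o m e → 6 * o * (m * e) ≡ 6 * m * (o * e)
      rearrange₁ = solve-∀
      rearrange₂ : ∀ m q p j → 6 * m * (q * (p * j)) ≡ 2 * p * q * (3 * m * j)
      rearrange₂ = solve-∀
      rearrange₃ : ∀ c e q t → c * e * (q * t) ≡ c * (q * e) * t
      rearrange₃ = solve-∀
      square : ∀ k → (2 + k) * (2 + k) ≡ (2 + k) * suc k + (2 + k)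
      square = solve-∀
      |pairs| : 2 * length (pairs K) ≡ (2 + k) * suc k
      |pairs| = +-cancelʳ-≡ (2 + k) _ _ (≡.trans
        (subst (λ l → 2 * length (pairs K) + l ≡ l * l) |K| (length-pairs K)) (square k))

-- Arithmetic

n<2^n : ∀ n → n < 2 ^ n
n<2^n zero    = z<s
n<2^n (suc n) = begin-strict
  suc n             ≤⟨ n<2^n n ⟩
  2 ^ n             <⟨ m<m+n (2 ^ n) (m^n>0 2 n) ⟩
  2 ^ n + 2 ^ n     ≡⟨ cong (2 ^ n +_) (sym (+-identityʳ _)) ⟩
  2 ^ suc n         ∎
  where open ≤-Reasoning

^-distribʳ-* : ∀ j x y → (x * y) ^ j ≡ x ^ j * y ^ j
^-distribʳ-* zero    x y = refl
^-distribʳ-* (suc j) x y = ≡.trans (cong (x * y *_) (^-distribʳ-* j x y)) (rearrange x y (x ^ j) (y ^ j))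
  where
  rearrange : ∀ x y u v → x * y * (u * v) ≡ x * u * (y * v)
  rearrange = solve-∀

-- Bernoulli's inequality (1 + 1/x)^j ≥ 1 + j/x, cleared of denominators.
bernoulli : ∀ x j → (x + j) * x ^ j ≤ x * suc x ^ j
bernoulli x zero    = ≤-reflexive (cong (_* 1) (+-identityʳ x))
bernoulli x (suc j) = begin
  (x + suc j) * (x * x ^ j)             ≤⟨ m≤m+n _ (j * x ^ j) ⟩
  (x + suc j) * (x * x ^ j) + j * x ^ j ≡⟨ rearrange x j (x ^ j) ⟩
  suc x * ((x + j) * x ^ j)             ≤⟨ *-monoʳ-≤ (suc x) (bernoulli x j) ⟩
  suc x * (x * suc x ^ j)               ≡⟨ commute (suc x) x (suc x ^ j) ⟩
  x * (suc x * suc x ^ j)               ∎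
  where
  open ≤-Reasoning
  rearrange : ∀ x j e → (x + suc j) * (x * e) + j * e ≡ suc x * ((x + j) * e)
  rearrange = solve-∀
  commute : ∀ u v w → u * (v * w) ≡ v * (u * w)
  commute = solve-∀

-- From n to n + 1 the left side grows by the factor 2 (n + 2). The right side grows at least as
-- much, since (1 + 1/(n+1))^(n+1) ≥ 2 by `bernoulli`.
2^n*[1+n]!≤[1+n]^[1+n] : ∀ n → 2 ^ n * suc n ! ≤ suc n ^ suc n
2^n*[1+n]!≤[1+n]^[1+n] zero    = ≤-refl
2^n*[1+n]!≤[1+n]^[1+n] (suc n) = begin
  2 ^ suc n * (suc (suc n) * suc n !)    ≡⟨ rearrange (2 ^ n) (2 + n) (suc n !) ⟩
  (2 + n) * (2 * (2 ^ n * suc n !))      ≤⟨ *-monoʳ-≤ (2 + n) (*-monoʳ-≤ 2 (2^n*[1+n]!≤[1+n]^[1+n] n)) ⟩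
  (2 + n) * (2 * suc n ^ suc n)          ≤⟨ *-monoʳ-≤ (2 + n) (*-cancelˡ-≤ (suc n) (≤-trans (≤-reflexive (double (suc n) _)) (bernoulli (suc n) (suc n)))) ⟩
  (2 + n) * (2 + n) ^ suc n              ∎
  where
  open ≤-Reasoning
  rearrange : ∀ e u f → 2 * e * (u * f) ≡ u * (2 * (e * f))
  rearrange = solve-∀
  double : ∀ x e → x * (2 * e) ≡ (x + x) * e
  double = solve-∀

power≤expScaled : ∀ k N → k ^ N ≤ expScaled k N
power≤expScaled k zero    = ≤-refl
power≤expScaled k (suc N) = m≤n+m _ _

-- Keeping only the term t ^ t / t ! of the exponential series.
ExpLe⇒2^ : ∀ t n → ExpLe (suc t) n → 2 ^ t ≤ n
ExpLe⇒2^ t n exp = *-cancelʳ-≤ (2 ^ t) n (suc t !) {{suc t !≢0}} (begin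
  2 ^ t * suc t !            ≤⟨ 2^n*[1+n]!≤[1+n]^[1+n] t ⟩
  suc t ^ suc t              ≤⟨ power≤expScaled (suc t) (suc t) ⟩
  expScaled (suc t) (suc t)  ≤⟨ exp (suc t) ⟩
  n * suc t !                ∎)
  where open ≤-Reasoning

-- The ratio 4^(k+1) / (2 k - 1)!! peaks at k = 2 with value 64/3; from there on the new odd factors
-- exceed 4.
oddFactorial-lower : ∀ k → 3 * 4 ^ suc k ≤ 64 * oddFactorial k
oddFactorial-lower 0 = m≤m+n 12 52
oddFactorial-lower 1 = m≤m+n 48 16
oddFactorial-lower 2 = ≤-refl
oddFactorial-lower (suc k@(suc (suc k′))) = begin
  3 * (4 * 4 ^ suc k)                     ≡⟨ commute 3 4 (4 ^ suc k) ⟩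
  4 * (3 * 4 ^ suc k)                     ≤⟨ *-mono-≤ 4≤ (oddFactorial-lower k) ⟩
  suc (2 * k) * (64 * oddFactorial k)     ≡⟨ commute (suc (2 * k)) 64 (oddFactorial k) ⟩
  64 * (suc (2 * k) * oddFactorial k)     ∎
  where
  open ≤-Reasoning
  commute : ∀ u v w → u * (v * w) ≡ v * (u * w)
  commute = solve-∀
  4≤ : 4 ≤ suc (2 * k)
  4≤ = ≤-trans (*-monoʳ-≤ 2 (s≤s (s≤s (z≤n {k′})))) (n≤1+n _)

32*[1+r]²≤9*r⁶ : ∀ r → 2 ≤ r → 32 * (suc r * suc r) ≤ 9 * r ^ 6
32*[1+r]²≤9*r⁶ r 2≤r = begin
  32 * (suc r * suc r)                      ≡⟨ split (suc r) ⟩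
  8 * ((2 * suc r) * (2 * suc r))           ≤⟨ *-mono-≤ 8≤r⁴ (*-mono-≤ 2+2r≤3r 2+2r≤3r) ⟩
  r ^ 4 * ((3 * r) * (3 * r))               ≡⟨ join r ⟩
  9 * r ^ 6                                 ∎
  where
  open ≤-Reasoning
  split : ∀ u → 32 * (u * u) ≡ 8 * ((2 * u) * (2 * u))
  split = solve-∀
  join : ∀ r → (r * (r * (r * (r * 1)))) * ((3 * r) * (3 * r)) ≡ 9 * (r * (r * (r * (r * (r * (r * 1))))))
  join = solve-∀
  8≤r⁴ : 8 ≤ r ^ 4
  8≤r⁴ = ≤-trans (m≤m+n 8 8) (^-monoˡ-≤ 4 2≤r)
  regroup : ∀ r → 2 * suc r ≡ 2 + 2 * r
  regroup = solve-∀
  2+2r≤3r : 2 * suc r ≤ 3 * r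
  2+2r≤3r = ≤-trans (≤-reflexive (regroup r)) (+-monoˡ-≤ (2 * r) 2≤r)

-- By Q ≤ 4 r, Q^r costs 4^r r^r; the 4^r cancels against the double factorial, and r⁷ absorbs the
-- remaining factors. The left coefficient k + 2 is the one `extract` requires for tuples of length
-- r.
density-bound : ∀ k M T → 1 ≤ k →
  6 * oddFactorial k * M ≤ (2 + k) * suc k * (3 + 4 * k) ^ suc k * T →
  (2 + k) * M ≤ suc k ^ (suc k + 7) * T
density-bound k M T 1≤k h = *-cancelˡ-≤ (18 * 4 ^ r) {{m*n≢0 18 (4 ^ r) {{_}} {{m^n≢0 4 r}}}} (begin
  18 * 4 ^ r * (suc r * M)                                 ≡⟨ rearrange₁ (4 ^ r) (suc r) M ⟩
  6 * (3 * 4 ^ r) * (suc r * M)                            ≤⟨ *-monoˡ-≤ (suc r * M) (*-monoʳ-≤ 6 (oddFactorial-lower k)) ⟩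
  6 * (64 * oddFactorial k) * (suc r * M)                  ≡⟨ rearrange₂ (oddFactorial k) (suc r) M ⟩
  64 * suc r * (6 * oddFactorial k * M)                    ≤⟨ *-monoʳ-≤ (64 * suc r) h ⟩
  64 * suc r * (suc r * r * (3 + 4 * k) ^ r * T)           ≤⟨ *-monoʳ-≤ (64 * suc r) (*-monoˡ-≤ T (*-monoʳ-≤ (suc r * r) Q^r≤)) ⟩
  64 * suc r * (suc r * r * (4 ^ r * r ^ r) * T)           ≡⟨ rearrange₃ (suc r) r (4 ^ r) (r ^ r) T ⟩
  2 * 4 ^ r * (32 * (suc r * suc r)) * (r * r ^ r * T)     ≤⟨ *-monoˡ-≤ (r * r ^ r * T) (*-monoʳ-≤ (2 * 4 ^ r) (32*[1+r]²≤9*r⁶ r (s≤s 1≤k))) ⟩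
  2 * 4 ^ r * (9 * r ^ 6) * (r * r ^ r * T)                ≡⟨ rearrange₄ (4 ^ r) (r ^ 6) r (r ^ r) T ⟩
  18 * 4 ^ r * (r ^ r * (r * r ^ 6) * T)                   ≡⟨ cong (λ z → 18 * 4 ^ r * (z * T)) (sym (^-distribˡ-+-* r r 7)) ⟩
  18 * 4 ^ r * (r ^ (r + 7) * T)                           ∎)
  where
  open ≤-Reasoning
  r = suc k
  rearrange₁ : ∀ f s M → 18 * f * (s * M) ≡ 6 * (3 * f) * (s * M)
  rearrange₁ = solve-∀
  rearrange₂ : ∀ o s M → 6 * (64 * o) * (s * M) ≡ 64 * s * (6 * o * M)
  rearrange₂ = solve-∀
  rearrange₃ : ∀ s r f e T → 64 * s * (s * r * (f * e) * T) ≡ 2 * f * (32 * (s * s)) * (r * e * T)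
  rearrange₃ = solve-∀
  rearrange₄ : ∀ f e r d T → 2 * f * (9 * e) * (r * d * T) ≡ 18 * f * (d * (r * e) * T)
  rearrange₄ = solve-∀
  four : ∀ k → suc (3 + 4 * k) ≡ 4 * suc k
  four = solve-∀
  Q^r≤ : (3 + 4 * k) ^ r ≤ 4 ^ r * r ^ r
  Q^r≤ = begin
    (3 + 4 * k) ^ r   ≤⟨ ^-monoˡ-≤ r (≤-trans (n≤1+n _) (≤-reflexive (four k))) ⟩
    (4 * r) ^ r       ≡⟨ ^-distribʳ-* r 4 r ⟩
    4 ^ r * r ^ r     ∎

-- With B = q r^(r(r+8)) the exponent q r^((r+7)(r+1)) of the theorem equals r⁷ B, and every other
-- quantity of the proof is bounded by a small power of 2 ^ B.
module Sizes (k q : ℕ) (1≤k : 1 ≤ k) (1≤q : 1 ≤ q) where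

  private
    r = suc k
    2≤r : 2 ≤ r
    2≤r = s≤s 1≤k

  -- The three factors 2 ^ B of m₀ pay for 2 L, P and 2 ^ P in `extract` with P = B. A fourth one,
  -- present in n, pays for the deletions.
  L B m₀ : ℕ
  L  = r ^ (r + 7)
  B  = q * r ^ (r * (r + 8))
  m₀ = 2 ^ (3 * B)

  private
    r^≤B : ∀ j → j ≤ r * (r + 8) → r ^ j ≤ B
    r^≤B j j≤ = ≤-trans (^-monoʳ-≤ r j≤) (m≤n*m _ q {{>-nonZero 1≤q}})

    2≤^⇒*≤ : ∀ i j → 2 ^ i * r ^ j ≤ r ^ (i + j)
    2≤^⇒*≤ i j = ≤-trans (*-monoˡ-≤ (r ^ j) (^-monoˡ-≤ i 2≤r)) (≤-reflexive (sym (^-distribˡ-+-* r i j)))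

    8+r≤ : r + 8 ≤ r * (r + 8)
    8+r≤ = m≤n*m (r + 8) r

    2*L≤ : 2 * L ≤ r ^ (r + 8)
    2*L≤ = ≤-trans (2≤^⇒*≤ 1 (r + 7)) (≤-reflexive (cong (r ^_) (sym (+-suc r 7))))

    4≤ : ∀ k → 3 + 4 * k ≤ 4 * suc k
    4≤ k = ≤-trans (n≤1+n _) (≤-reflexive (four k))
      where
      four : ∀ k → suc (3 + 4 * k) ≡ 4 * suc k
      four = solve-∀

  1≤L : 1 ≤ L
  1≤L = m^n>0 r (r + 7)

  1≤B : 1 ≤ B
  1≤B = r^≤B 0 z≤n

  q*[2L]^r≤B : q * (2 * L) ^ r ≤ B
  q*[2L]^r≤B = *-monoʳ-≤ q (begin
    (2 * L) ^ r           ≤⟨ ^-monoˡ-≤ r 2*L≤ ⟩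
    (r ^ (r + 8)) ^ r     ≡⟨ ^-*-assoc r (r + 8) r ⟩
    r ^ ((r + 8) * r)     ≡⟨ cong (r ^_) (*-comm (r + 8) r) ⟩
    r ^ (r * (r + 8))     ∎)
    where open ≤-Reasoning

  private
    B≤2^B : B ≤ 2 ^ B
    B≤2^B = <⇒≤ (n<2^n B)

    triple : 2 ^ B * (2 ^ B * 2 ^ B) ≡ m₀
    triple = ≡.trans (cong (2 ^ B *_) (sym (^-distribˡ-+-* 2 B B)))
      (≡.trans (sym (^-distribˡ-+-* 2 B (B + B))) (cong (λ z → 2 ^ (B + (B + z))) (sym (+-identityʳ B))))

  2L*[B*2^B]≤m₀ : 2 * L * (B * 2 ^ B) ≤ m₀
  2L*[B*2^B]≤m₀ = ≤-trans
    (*-mono-≤ (≤-trans 2*L≤ (≤-trans (r^≤B (r + 8) 8+r≤) B≤2^B)) (*-monoˡ-≤ (2 ^ B) B≤2^B))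
    (≤-reflexive triple)

  2rQ≤m₀ : 2 * (r * (3 + 4 * k)) ≤ m₀
  2rQ≤m₀ = begin
    2 * (r * (3 + 4 * k))    ≤⟨ *-monoʳ-≤ 2 (*-monoʳ-≤ r (4≤ k)) ⟩
    2 * (r * (4 * r))        ≡⟨ collect r ⟩
    2 ^ 3 * r ^ 2            ≤⟨ 2≤^⇒*≤ 3 2 ⟩
    r ^ 5                    ≤⟨ r^≤B 5 (≤-trans (≤-trans (m≤m+n 5 3) (m≤n+m 8 r)) 8+r≤) ⟩
    B                        ≤⟨ B≤2^B ⟩
    2 ^ B                    ≤⟨ ^-monoʳ-≤ 2 (m≤m+n B (B + (B + 0))) ⟩
    m₀                       ∎
    where
    open ≤-Reasoning
    collect : ∀ r → 2 * (r * (4 * r)) ≡ 8 * (r * (r * 1))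
    collect = solve-∀

  module _ (n : ℕ) (exp : ExpLe (q * r ^ ((r + 7) * (r + 1))) n) where

    2^4B≤n : 2 ^ (4 * B) ≤ n
    2^4B≤n = go (q * r ^ ((r + 7) * (r + 1))) exp large
      where
      open ≤-Reasoning
      exponent : ∀ r → (r + 7) * (r + 1) ≡ 7 + r * (r + 8)
      exponent = solve-∀
      commute : ∀ u v w → u * (v * w) ≡ v * (u * w)
      commute = solve-∀
      -- The successor is the 1 that `ExpLe⇒2^` loses in the exponent; r⁷ ≥ 5 leaves room for it.
      large : suc (4 * B) ≤ q * r ^ ((r + 7) * (r + 1))
      large = begin
        suc (4 * B)                               ≤⟨ +-monoˡ-≤ (4 * B) 1≤B ⟩
        5 * B                                     ≤⟨ *-monoˡ-≤ B (≤-trans (m≤m+n 5 123) (^-monoˡ-≤ 7 2≤r)) ⟩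
        r ^ 7 * (q * r ^ (r * (r + 8)))           ≡⟨ commute (r ^ 7) q _ ⟩
        q * (r ^ 7 * r ^ (r * (r + 8)))           ≡⟨ cong (q *_) (sym (^-distribˡ-+-* r 7 (r * (r + 8)))) ⟩
        q * r ^ (7 + r * (r + 8))                 ≡⟨ cong (λ z → q * r ^ z) (sym (exponent r)) ⟩
        q * r ^ ((r + 7) * (r + 1))               ∎
      go : ∀ x → ExpLe x n → suc (4 * B) ≤ x → 2 ^ (4 * B) ≤ n
      go (suc t) exp (s≤s 4B≤t) = ≤-trans (^-monoʳ-≤ 2 4B≤t) (ExpLe⇒2^ t n exp)

    2≤n : 2 ≤ n
    2≤n = ≤-trans (^-monoʳ-≤ 2 (≤-trans 1≤B (m≤n*m B 4))) 2^4B≤n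

    -- Room for 2 Q m₀ deletions that still leave m₀ vertices.
    [2Q+1]m₀≤n : 2 * (3 + 4 * k) * m₀ + m₀ ≤ n
    [2Q+1]m₀≤n = begin
      2 * (3 + 4 * k) * m₀ + m₀      ≡⟨ +-comm _ m₀ ⟩
      suc (2 * (3 + 4 * k)) * m₀     ≤⟨ *-monoˡ-≤ m₀ (begin
         suc (2 * (3 + 4 * k))         ≤⟨ n≤1+n _ ⟩
         suc (suc (2 * (3 + 4 * k)))   ≡⟨ collect k ⟩
         2 ^ 3 * r ^ 1                 ≤⟨ 2≤^⇒*≤ 3 1 ⟩
         r ^ 4                         ≤⟨ r^≤B 4 (≤-trans (≤-trans (m≤m+n 4 4) (m≤n+m 8 r)) 8+r≤) ⟩
         B                             ≤⟨ B≤2^B ⟩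
         2 ^ B                         ∎) ⟩
      2 ^ B * 2 ^ (3 * B)            ≡⟨ sym (^-distribˡ-+-* 2 B (3 * B)) ⟩
      2 ^ (4 * B)                    ≤⟨ 2^4B≤n ⟩
      n                              ∎
      where
      open ≤-Reasoning
      collect : ∀ k → suc (suc (2 * (3 + 4 * k))) ≡ 8 * (suc k * 1)
      collect = solve-∀

-- The embedding

lookup-unique : {A : Set} (xs : List A) → Unique xs → ∀ i j → lookup xs i ≡ lookup xs j → i ≡ j
lookup-unique (x ∷ xs) (x≢ ∷ xs!) zero    zero    e = refl
lookup-unique (x ∷ xs) (x≢ ∷ xs!) zero    (suc j) e = contradiction e (All.lookup x≢ (∈-lookup j))
lookup-unique (x ∷ xs) (x≢ ∷ xs!) (suc i) zero    e = contradiction (sym e) (All.lookup x≢ (∈-lookup i))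
lookup-unique (x ∷ xs) (x≢ ∷ xs!) (suc i) (suc j) e = cong suc (lookup-unique xs xs! i j e)

module _ {n : ℕ} (u : Fin n) where

  other : Fin n → Bool
  other x = not (does (x Fin.≟ u))

  other-true : ∀ {x} → other x ≡ true → u ≢ x
  other-true {x} e refl = contradiction (≡.trans (sym (cong not (dec-true (x Fin.≟ x) refl))) e) λ ()

  other-all : ∀ {xs} → All (u ≢_) xs → length (filterᵇ other xs) ≡ length xs
  other-all [] = refl
  other-all {x ∷ xs} (u≢x ∷ u≢) with x Fin.≟ u
  ... | yes x≡u = contradiction (sym x≡u) u≢x
  ... | no  _   = cong suc (other-all u≢)

  length-others : ∀ {xs} → Unique xs → length xs ≤ suc (length (filterᵇ other xs))
  length-others [] = z≤n
  length-others {x ∷ xs} (x≢ ∷ xs!) with x Fin.≟ u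
  ... | yes refl = s≤s (≤-reflexive (sym (other-all x≢)))
  ... | no  _    = s≤s (length-others xs!)

module Embedding {n : ℕ} (G : Graph n) (W : List (Fin n)) (W! : Unique W) where
  a = adj G
  open Counting a
  open Extraction a W W!
  open Density a (Graph.sym G) W W!

  Adj-sym : ∀ {x y} → Adj x y → Adj y x
  Adj-sym {x} {y} = ≡.trans (Graph.sym G y x)

  Adj⇒≢ : ∀ {x y} → Adj x y → x ≢ y
  Adj⇒≢ {x} xy refl = contradiction (≡.trans (sym xy) (irrefl G x)) λ ()

  cross-lookup : ∀ {k} (t t′ : Vec (Fin n) k) → CrossAdj t t′ → ∀ i j → i ≢ j → Adj (Vec.lookup t i) (Vec.lookup t′ j)
  cross-lookup (x ∷ R) (y ∷ S) _             zero    zero    i≢j = contradiction refl i≢j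
  cross-lookup (x ∷ R) (y ∷ S) (xS , _ , _)  zero    (suc j) _   = VecAll.lookup⁺ xS j
  cross-lookup (x ∷ R) (y ∷ S) (_ , yR , _)  (suc i) zero    _   = Adj-sym (VecAll.lookup⁺ yR i)
  cross-lookup (x ∷ R) (y ∷ S) (_ , _ , RS)  (suc i) (suc j) i≢j = cross-lookup R S RS i j (i≢j ∘ cong suc)

  module _ {k q s : ℕ} (u v : Fin n) (uv : Adj u v) (s≤q : s ≤ q)
    (F : Family {suc k} q (jointTuple (u , v))) where
    open Family F

    private
      column : Fin (suc k) → List (Fin n)
      column i = map (λ t → Vec.lookup t i) members

      column-unique : ∀ i → Unique (column i)
      column-unique i = AllPairs.map⁺ (AllPairs.map (λ t≢t′ → Pointwise.lookup t≢t′ i) distinct)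

      length-column : ∀ i → length (column i) ≡ q
      length-column i = ≡.trans (length-map _ members) size

      rest : List (Fin n)
      rest = filterᵇ (other v) (filterᵇ (other u) (column zero))

      -- u and v come first because `kPlusAdj` puts the extra edge between positions 0 and 1. They
      -- may occur among the y, so they are removed there; at most two entries go and two are added.
      part : Fin (suc k) → List (Fin n)
      part zero    = u ∷ v ∷ rest
      part (suc i) = column (suc i)

      part-unique : ∀ i → Unique (part i)
      part-unique (suc i) = column-unique (suc i)
      part-unique zero =
        (Adj⇒≢ uv ∷ All.tabulate (λ x∈ → other-true u (proj₂ (∈-filterᵇ⁻ (other u) {column zero} (proj₁ (∈-filterᵇ⁻ (other v) x∈)))))) ∷
        All.tabulate (λ x∈ → other-true v (proj₂ (∈-filterᵇ⁻ (other v) {filterᵇ (other u) (column zero)} x∈))) ∷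
        AllPairs.filter⁺ (T? ∘ other v) (AllPairs.filter⁺ (T? ∘ other u) (column-unique zero))

      part-large : ∀ i → s ≤ length (part i)
      part-large (suc i) = ≤-trans s≤q (≤-reflexive (sym (length-column (suc i))))
      part-large zero    = begin
        s                                                    ≤⟨ s≤q ⟩
        q                                                    ≡⟨ sym (length-column zero) ⟩
        length (column zero)                                 ≤⟨ length-others u (column-unique zero) ⟩
        suc (length (filterᵇ (other u) (column zero)))       ≤⟨ s≤s (length-others v (AllPairs.filter⁺ (T? ∘ other u) (column-unique zero))) ⟩
        suc (suc (length rest))                              ∎
        where open ≤-Reasoning

      columns-adjacent : ∀ {i j x y} → i ≢ j → x ∈ column i → y ∈ column j → Adj x y
      columns-adjacent {i} {j} i≢j x∈ y∈ with ∈-map⁻ _ x∈ | ∈-map⁻ _ y∈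
      ... | t , t∈ , refl | t′ , t′∈ , refl = cross-lookup t t′ (cross t∈ t′∈) i j i≢j

      hub-adjacent : ∀ {j y} → y ∈ column (suc j) → Adj u y × Adj v y
      hub-adjacent {j} y∈ with ∈-map⁻ _ y∈
      ... | (x ∷ R) , t∈ , refl = VecAll.lookup⁺ (jointTuple-adj u v x R (valid t∈)) j

      zero-adjacent : ∀ {j x y} → x ∈ part zero → y ∈ column (suc j) → Adj x y
      zero-adjacent (here refl)         y∈ = proj₁ (hub-adjacent y∈)
      zero-adjacent (there (here refl)) y∈ = proj₂ (hub-adjacent y∈)
      zero-adjacent (there (there x∈))  y∈ =
        columns-adjacent (λ ()) (proj₁ (∈-filterᵇ⁻ (other u) (proj₁ (∈-filterᵇ⁻ (other v) x∈)))) y∈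

      parts-adjacent : ∀ {i j x y} → i ≢ j → x ∈ part i → y ∈ part j → Adj x y
      parts-adjacent {zero}  {zero}  i≢j _  _  = contradiction refl i≢j
      parts-adjacent {zero}  {suc j} _   x∈ y∈ = zero-adjacent x∈ y∈
      parts-adjacent {suc i} {zero}  _   x∈ y∈ = Adj-sym (zero-adjacent y∈ x∈)
      parts-adjacent {suc i} {suc j} i≢j x∈ y∈ = columns-adjacent i≢j x∈ y∈

      f : Fin (suc k) × Fin s → Fin n
      f (i , c) = lookup (part i) (inject≤ c (part-large i))

      f-injective : ∀ {x y} → f x ≡ f y → x ≡ y
      f-injective {i , c} {j , d} e with i Fin.≟ j
      -- Vertices of different parts are adjacent, hence distinct.
      ... | no i≢j   = contradiction e (Adj⇒≢ (parts-adjacent i≢j (∈-lookup (inject≤ c (part-large i))) (∈-lookup (inject≤ d (part-large j)))))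
      ... | yes refl = cong (i ,_) (Fin.inject≤-injective (part-large i) (part-large i) c d
                         (lookup-unique (part i) (part-unique i) _ _ e))

      -- Generalising s and the list allows matching on c and d; only the positions 0 and 1 survive.
      edge : ∀ {s} (x y : Fin n) (zs : List (Fin n)) → Adj x y → (c d : Fin s) →
        .(h : s ≤ length (x ∷ y ∷ zs)) →
        (((toℕ c ≡ᵇ 0) ∧ (toℕ d ≡ᵇ 1)) ∨ ((toℕ c ≡ᵇ 1) ∧ (toℕ d ≡ᵇ 0))) ≡ true →
        Adj (lookup (x ∷ y ∷ zs) (inject≤ c h)) (lookup (x ∷ y ∷ zs) (inject≤ d h))
      edge x y zs xy zero       (suc zero) h _ = xy
      edge x y zs xy (suc zero) zero       h _ = Adj-sym xy

      f-adjacent : ∀ x y → kPlusAdj (suc k) s x y ≡ true → Adj (f x) (f y)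
      f-adjacent (i , c) (j , d) e with i Fin.≟ j
      ... | no i≢j = parts-adjacent i≢j (∈-lookup (inject≤ c (part-large i))) (∈-lookup (inject≤ d (part-large j)))
      f-adjacent (zero , c) (zero , d) e | yes refl = edge u v rest uv c d (part-large zero) e
      f-adjacent (suc i , c) (suc i , d) e | yes refl rewrite ≡ᵇ-refl (toℕ i) = contradiction e λ ()

    containsKPlus : ContainsKPlus G (suc k) s
    containsKPlus = f , f-injective , f-adjacent

-- From the edge count to the subgraph

module _ (k q : ℕ) (1≤k : 1 ≤ k) (1≤q : 1 ≤ q) where
  open Sizes k q 1≤k 1≤q

  private
    Q = 3 + 4 * k

  dense-subset : ∀ n (G : Graph (2 + n)) → 2 * Q * m₀ + m₀ ≤ 2 + n →
    edgeCount G ≡ turanNumber (suc k) (2 + n) + 1 →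
    Deletion.DenseSubset (adj G) (Graph.sym G) (irrefl G) k m₀
  dense-subset n G large edges = deleteSparse k m₀ J 2rQ≤m₀ (m+n≤o⇒m≤o∸n (2 * Q * m₀) large) J (allFin N)
    (≡.trans |V| (sym (m∸n+n≡m (≤-trans (m≤n+m m₀ _) large)))) (allFin⁺ N) ≤-refl
    (+-monoˡ-< (J * m₀) (*-monoʳ-< (suc k * Q)
      (subst (λ l → nonEdges (allFin N) < samePart k l) (sym |V|) (turán-excess k n G edges))))
    where
    open Deletion (adj G) (Graph.sym G) (irrefl G)
    open Counting (adj G)
    N = 2 + n
    -- All deletions down to m₀ vertices are allowed. Initially j = J, so the invariant is just a
    -- positive surplus.
    J = N ∸ m₀
    |V| : length (allFin N) ≡ N
    |V| = length-tabulate {n = N} (λ i → i)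

  dense-subset⇒containsKPlus : ∀ {n} (G : Graph n) s → s ≤ q →
    Deletion.DenseSubset (adj G) (Graph.sym G) (irrefl G) k m₀ → ContainsKPlus G (suc k) s
  dense-subset⇒containsKPlus G s s≤q D = finish (dense-joint k minDegree dense)
    where
    open Deletion (adj G) (Graph.sym G) (irrefl G)
    open DenseSubset D renaming (support to W; unique to W!)
    open Counting (adj G)
    open Density (adj G) (Graph.sym G) W W!
    open Extraction (adj G) W W!

    finish : (∃ λ e → Adj (proj₁ e) (proj₂ e) ×
      6 * oddFactorial k * m ^ suc k ≤ (2 + k) * suc k * Q ^ suc k * ♯ (jointTuple e) (tuples (suc k))) →
      ContainsKPlus G (suc k) s
    finish (e , uv , many) = Embedding.containsKPlus G W W! (proj₁ e) (proj₂ e) uv s≤q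
      (extract L B 1≤L 1≤B (≤-trans 2L*[B*2^B]≤m₀ large) (suc k) q (jointTuple e)
        (λ {t} → jointTuple-cross e t) 1≤q q*[2L]^r≤B
        (density-bound k (m ^ suc k) (♯ (jointTuple e) (tuples (suc k))) 1≤k many))

  containsKPlus-large : ∀ n s → s ≤ q → ExpLe (q * suc k ^ ((suc k + 7) * (suc k + 1))) n →
    (G : Graph n) → edgeCount G ≡ turanNumber (suc k) n + 1 → ContainsKPlus G (suc k) s
  containsKPlus-large n s s≤q exp = go n (2≤n n exp) ([2Q+1]m₀≤n n exp)
    where
    go : ∀ n → 2 ≤ n → 2 * Q * m₀ + m₀ ≤ n →
      (G : Graph n) → edgeCount G ≡ turanNumber (suc k) n + 1 → ContainsKPlus G (suc k) s
    go (suc (suc n)) _ large G edges = dense-subset⇒containsKPlus G s s≤q (dense-subset n G large edges)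

theorem2 : (r n s : ℕ) → 2 ≤ r →
    ExpLe (2 * r ^ ((r + 7) * (r + 1))) n →
    ExpLe (s * r ^ ((r + 7) * (r + 1))) n →
    ¬ ExpLe (suc s * r ^ ((r + 7) * (r + 1))) n →
    (G : Graph n) → edgeCount G ≡ turanNumber r n + 1 →
    ContainsKPlus G r s
theorem2 (suc k) n s (s≤s 1≤k) exp₂ expₛ _ with ≤-total 1 s
... | inj₁ 1≤s = containsKPlus-large k s 1≤k 1≤s n s ≤-refl expₛ
-- The case s ≤ 1 includes s = 0, where q = s would violate 1 ≤ q. The bound n ≥ e^(2/c) permits q =
-- 2, and only s vertices of each part are kept.
... | inj₂ s≤1 = containsKPlus-large k 2 1≤k (s≤s z≤n) n s (≤-trans s≤1 (n≤1+n 1)) exp₂
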